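{- Let $B$ be the simplicial complex on vertex set $\{v_1,\dots,v_5\}$ whose edge set is the downward closure of $\{v_3v_4,\ v_1v_2v_3,\ v_1v_4v_5\}$. There is a constant $C\in\mathbb N$ such that for every $n\ge 5$, $$\mathrm{ex}(n,B)\le \frac98\binom n2+\frac{21}{16}n+C.$$
   Context: A simplicial complex is a pair $H=(V,E)$ with $E\subseteq\mathscr P(V)$ closed under taking subsets; all subsets of $E$ (including the empty set and singletons) count as edges. $H$ contains a copy of $F$ if there is an injection $\varphi:V(F)\to V(H)$ with $\varphi(e)\in E(H)$ for every $e\in E(F)$. $\mathrm{ex}(n,F)$ is the maximum number of edges of a simplicial complex on $n$ vertices containing no copy of $F$. -}

module Defs where

open import Data.Nat using (ℕ; zero; suc; _+_)
open import Data.Bool using (Bool; true; false; if_then_else_; _∧_; _∨_)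
open import Data.List using (List; []; _∷_; map; _++_)
open import Data.Nat.ListAction using (sum)
open import Data.Vec using (Vec; []; _∷_; lookup; tabulate)
open import Data.Fin using (Fin; zero; suc; _≟_)
open import Data.Fin.Subset using (Subset; _⊆_; inside; outside)
open import Data.Sum using (_⊎_)
open import Data.Product using (Σ; _×_)
open import Function.Definitions using (Injective)
open import Relation.Binary.PropositionalEquality using (_≡_)
open import Relation.Nullary.Decidable using (isYes)

allSubsets : (n : ℕ) → List (Subset n)
allSubsets zero = [] ∷ []
allSubsets (suc n) = map (inside ∷_) (allSubsets n) ++ map (outside ∷_) (allSubsets n)

record SimplicialComplex (n : ℕ) : Set where
  field
    edge     : Subset n → Bool
    downward : ∀ (s t : Subset n) → s ⊆ t → edge t ≡ true → edge s ≡ true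
open SimplicialComplex public

-- Number of edges (all subsets belonging to E, including ∅ and singletons).
numEdges : ∀ {n} → SimplicialComplex n → ℕ
numEdges {n} H = sum (map (λ s → if edge H s then 1 else 0) (allSubsets n))

anyFin : ∀ {m} → (Fin m → Bool) → Bool
anyFin {zero} f = false
anyFin {suc m} f = f zero ∨ anyFin (λ i → f (suc i))

image : ∀ {m n} → (Fin m → Fin n) → Subset m → Subset n
image φ s = tabulate (λ j → anyFin (λ i → lookup s i ∧ isYes (φ i ≟ j)))

ContainsCopy : ∀ {m n} → (Subset m → Set) → SimplicialComplex n → Set
ContainsCopy {m} {n} FEdge H =
  Σ (Fin m → Fin n) (λ φ → Injective _≡_ _≡_ φ × (∀ (e : Subset m) → FEdge e → edge H (image φ e) ≡ true))

-- The complex B on {v1,...,v5} (v_i ↦ index i-1): downward closure of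
-- {v3v4, v1v2v3, v1v4v5}.
b34 b123 b145 : Subset 5
b34  = outside ∷ outside ∷ inside ∷ inside ∷ outside ∷ []
b123 = inside ∷ inside ∷ inside ∷ outside ∷ outside ∷ []
b145 = inside ∷ outside ∷ outside ∷ inside ∷ inside ∷ []

BEdge : Subset 5 → Set
BEdge e = e ⊆ b34 ⊎ (e ⊆ b123 ⊎ e ⊆ b145)

{-# OPTIONS --safe #-}
module Submission where

-- Let L(v) be the link graph of a vertex v. B-freeness says that two disjoint edges of L(v) have no
-- edge of the complex between them; in particular L(v) has no path on four vertices. Call a pair heavy
-- if it lies in at least three triples. A triple has at most one heavy pair, so it is either a page of
-- a book on a heavy spine or light, all of whose pairs lie in at most two triples. Charge each
-- triple of a book to its page and each light triple and each quadruple evenly to its vertices, let v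
-- receive the largest charge, and let S be the set of vertices used by the charges of v.
--
-- * Inside S the complex has only bounded degree (degree one if there are no light triples).
-- * If a ∈ S has partner a′ in L(v), then every vertex used by the charges of a (up to boundedly
--   many, in the light case) lies outside S and is not adjacent to a′. So the charges of the vertices
--   of S are paid for by the missing pairs between S and its complement.
--
-- With s = |S| the triples and quadruples thus exceed the missing pairs by at most
-- (n − s) s/2 − s²/2 + s + O(1) ≤ (n + 2)²/16 + O(1), with the maximum at s = (n + 2)/4.

open import Defs
open import Data.Nat using (ℕ; zero; suc; _+_; _*_; _≤_; z≤n; s≤s; _≤?_)
open import Data.Nat.Combinatorics using (_C_; nC1≡n; nCk+nC[k+1]≡[n+1]C[k+1])
import Data.Nat.ListAction as ListAction
open import Data.Nat.ListAction.Properties using (sum-++)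
open import Data.Nat.Properties hiding (_≟_; suc-injective)
open import Data.Nat.Tactic.RingSolver using (solve-∀)
open import Algebra.Properties.CommutativeSemigroup +-commutativeSemigroup using (interchange)
open import Algebra.Properties.CommutativeSemigroup *-commutativeSemigroup using (x∙yz≈y∙xz)
open import Algebra.Properties.Semiring.Sum +-*-semiring using (sum; sum-cong-≗; ∑-distrib-+; ∑-comm; *-distribˡ-sum; *-distribʳ-sum)
open import Data.Bool using (Bool; true; false; not; if_then_else_) renaming (_≟_ to _≟ᵇ_)
open import Data.Empty using (⊥; ⊥-elim)
open import Data.Fin using (Fin; zero; suc; _≟_)
open import Data.Fin.Patterns using (0F; 1F; 2F; 3F; 4F)
open import Data.Fin.Properties using (any?; suc-injective)
open import Data.Fin.Subset using (Subset; ∣_∣; _∈_; _⊆_) renaming (⊥ to ∅)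
open import Data.List using (List; []; _∷_; map; allFin)
open import Data.List.Extrema.Nat using (argmax; f[xs]≤f[argmax])
import Data.List.Membership.Propositional as List
open import Data.List.Membership.Propositional.Properties using (∈-allFin)
open import Data.List.Properties using (map-++; map-∘)
open import Data.List.Relation.Unary.All as All using (All; []; _∷_)
open import Data.List.Relation.Unary.AllPairs using ([]; _∷_)
open import Data.List.Relation.Unary.Any using (here; there)
import Data.List.Relation.Unary.Unique.DecPropositional as UniqueDec
open import Data.List.Relation.Unary.Unique.Propositional using (Unique)
open import Data.Product using (Σ; ∃; _×_; _,_; proj₁; proj₂)
open import Data.Sum using (_⊎_; inj₁; inj₂)
open import Data.Vec using (Vec; []; _∷_; lookup; _[_]≔_; here; there)
open import Data.Vec.Properties using ([]=⇒lookup; lookup⇒[]=; lookup∘update; lookup∘update′; lookup∘tabulate; lookup-replicate)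
import Data.Vec.Relation.Unary.All as VecAll
import Data.Vec.Relation.Unary.AllPairs as VecPairs
open import Data.Vec.Relation.Unary.Unique.Propositional.Properties using (lookup-injective)
open import Function using (_∘_)
open import Function.Definitions using (Injective)
open import Relation.Binary.PropositionalEquality using (_≡_; _≢_; refl; sym; trans; cong; cong₂; subst; ≢-sym; module ≡-Reasoning)
open import Relation.Nullary using (¬_; Dec; yes; no; does; contradiction)
open import Relation.Nullary.Decidable using (¬?; _×-dec_; _⊎-dec_)

-- Indicators and finite sums

private variable
  P Q : Set

⟦_⟧ : Dec P → ℕ
⟦ d ⟧ = if does d then 1 else 0

⟦⟧≤1 : (d : Dec P) → ⟦ d ⟧ ≤ 1
⟦⟧≤1 (yes _) = ≤-refl
⟦⟧≤1 (no _)  = z≤n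

⟦⟧-true : (d : Dec P) → P → ⟦ d ⟧ ≡ 1
⟦⟧-true (yes _) _ = refl
⟦⟧-true (no ¬p) p = contradiction p ¬p

⟦⟧-pos : (d : Dec P) → P → 1 ≤ ⟦ d ⟧
⟦⟧-pos d p = ≤-reflexive (sym (⟦⟧-true d p))

⟦⟧-false : (d : Dec P) → ¬ P → ⟦ d ⟧ ≡ 0
⟦⟧-false (yes p) ¬p = contradiction p ¬p
⟦⟧-false (no _)  _  = refl

⟦⟧-≤ : (d : Dec P) {m : ℕ} → (P → 1 ≤ m) → ⟦ d ⟧ ≤ m
⟦⟧-≤ (yes p) h = h p
⟦⟧-≤ (no _)  _ = z≤n

⟦⟧-mono : (d : Dec P) (e : Dec Q) → (P → Q) → ⟦ d ⟧ ≤ ⟦ e ⟧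
⟦⟧-mono d e f = ⟦⟧-≤ d (⟦⟧-pos e ∘ f)

⟦⟧*-mono : (d : Dec P) {m k : ℕ} → (P → m ≤ k) → ⟦ d ⟧ * m ≤ ⟦ d ⟧ * k
⟦⟧*-mono (yes p) h = *-monoʳ-≤ 1 (h p)
⟦⟧*-mono (no _)  _ = z≤n

sum-mono : ∀ {n} {f g : Fin n → ℕ} → (∀ i → f i ≤ g i) → sum f ≤ sum g
sum-mono {zero}  h = z≤n
sum-mono {suc n} h = +-mono-≤ (h zero) (sum-mono (h ∘ suc))

term≤sum : ∀ {n} (f : Fin n → ℕ) i → f i ≤ sum f
term≤sum f zero    = m≤m+n _ _
term≤sum f (suc i) = ≤-trans (term≤sum (f ∘ suc) i) (m≤n+m _ (f zero))

sum-const : ∀ n k → sum {n} (λ _ → k) ≡ n * k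
sum-const zero    k = refl
sum-const (suc n) k = cong (k +_) (sum-const n k)

sum-zero : ∀ n → sum {n} (λ _ → 0) ≡ 0
sum-zero n = trans (sum-const n 0) (*-zeroʳ n)

sum-≟ : ∀ {n} (a : Fin n) → sum (λ z → ⟦ z ≟ a ⟧) ≡ 1
sum-≟ {suc n} zero    = cong suc (sum-zero n)
sum-≟ {suc n} (suc a) = trans (sum-cong-≗ (λ i → ⟦suc⟧ i)) (sum-≟ a)
  where
  ⟦suc⟧ : ∀ i → ⟦ suc i ≟ suc a ⟧ ≡ ⟦ i ≟ a ⟧
  ⟦suc⟧ i with i ≟ a
  ... | yes _ = refl
  ... | no _  = refl

module _ {n : ℕ} {P : Fin n → Set} (P? : ∀ z → Dec (P z)) where

  count-unique : (∀ x y → P x → P y → x ≡ y) → sum (λ z → ⟦ P? z ⟧) ≤ 1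
  count-unique uniq with any? P?
  ... | yes (a , pa) = ≤-trans (sum-mono (λ z → ⟦⟧-mono (P? z) (z ≟ a) (λ pz → uniq z a pz pa))) (≤-reflexive (sum-≟ a))
  ... | no ¬p = ≤-trans (≤-reflexive (trans (sum-cong-≗ (λ z → ⟦⟧-false (P? z) (λ pz → ¬p (z , pz)))) (sum-zero n))) z≤n

  -- Otherwise `P` is covered by `a` and `b`, which caps the count at 2. It supplies a fresh page of
  -- a heavy pair.
  third : 3 ≤ sum (λ z → ⟦ P? z ⟧) → ∀ a b → ∃ λ z → P z × z ≢ a × z ≢ b
  third h a b with any? (λ z → P? z ×-dec ¬? (z ≟ a) ×-dec ¬? (z ≟ b))
  ... | yes w = w
  ... | no ¬w = contradiction (≤-trans h bound) λ { (s≤s (s≤s ())) }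
    where
    cover : ∀ z → P z → 1 ≤ ⟦ z ≟ a ⟧ + ⟦ z ≟ b ⟧
    cover z pz with z ≟ a | z ≟ b
    ... | yes _   | _       = s≤s z≤n
    ... | no _    | yes _   = s≤s z≤n
    ... | no z≢a  | no z≢b  = contradiction (z , pz , z≢a , z≢b) ¬w
    bound : sum (λ z → ⟦ P? z ⟧) ≤ 2
    bound = begin
      sum (λ z → ⟦ P? z ⟧)                         ≤⟨ sum-mono (λ z → ⟦⟧-≤ (P? z) (cover z)) ⟩
      sum (λ z → ⟦ z ≟ a ⟧ + ⟦ z ≟ b ⟧)            ≡⟨ ∑-distrib-+ (λ z → ⟦ z ≟ a ⟧) _ ⟩
      sum (λ z → ⟦ z ≟ a ⟧) + sum (λ z → ⟦ z ≟ b ⟧) ≡⟨ cong₂ _+_ (sum-≟ a) (sum-≟ b) ⟩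
      2                                            ∎
      where open ≤-Reasoning

module _ {n : ℕ} where

  sum₂ : (Fin n → Fin n → ℕ) → ℕ
  sum₂ f = sum λ x → sum (f x)

  sum₃ : (Fin n → Fin n → Fin n → ℕ) → ℕ
  sum₃ f = sum λ x → sum₂ (f x)

  sum₂-cong : ∀ {f g} → (∀ x y → f x y ≡ g x y) → sum₂ f ≡ sum₂ g
  sum₂-cong h = sum-cong-≗ λ x → sum-cong-≗ (h x)

  sum₂-mono : ∀ {f g} → (∀ x y → f x y ≤ g x y) → sum₂ f ≤ sum₂ g
  sum₂-mono h = sum-mono λ x → sum-mono (h x)

  sum₃-mono : ∀ {f g} → (∀ x y z → f x y z ≤ g x y z) → sum₃ f ≤ sum₃ g
  sum₃-mono h = sum-mono λ x → sum₂-mono (h x)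

  sum₂-+ : ∀ f g → sum₂ (λ x y → f x y + g x y) ≡ sum₂ f + sum₂ g
  sum₂-+ f g = trans (sum-cong-≗ λ x → ∑-distrib-+ (f x) (g x)) (∑-distrib-+ (λ x → sum (f x)) _)

  sum₃-+ : ∀ f g → sum₃ (λ x y z → f x y z + g x y z) ≡ sum₃ f + sum₃ g
  sum₃-+ f g = trans (sum-cong-≗ λ x → sum₂-+ (f x) (g x)) (∑-distrib-+ (λ x → sum₂ (f x)) _)

  sum₂-* : ∀ k f → sum₂ (λ x y → k * f x y) ≡ k * sum₂ f
  sum₂-* k f = sym (trans (*-distribˡ-sum k (λ x → sum (f x))) (sum-cong-≗ λ x → *-distribˡ-sum k (f x)))

  sum₂-product : ∀ (f g : Fin n → ℕ) → sum₂ (λ x y → f x * g y) ≡ sum f * sum g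
  sum₂-product f g = sym (trans (*-distribʳ-sum (sum g) f) (sum-cong-≗ λ x → *-distribˡ-sum (f x) g))

-- Links in a B-free complex

-- The pairs, triples and quadruples of a complex as relations on ordered tuples of distinct vertices.
record LinkSystem (n : ℕ) : Set₁ where
  field
    Adj       : Fin n → Fin n → Set
    Tri       : Fin n → Fin n → Fin n → Set
    Quad      : Fin n → Fin n → Fin n → Fin n → Set
    adj?      : ∀ x y → Dec (Adj x y)
    tri?      : ∀ x y z → Dec (Tri x y z)
    quad?     : ∀ x y z w → Dec (Quad x y z w)
    adj-irr   : ∀ {x y} → Adj x y → x ≢ y
    adj-sym   : ∀ {x y} → Adj x y → Adj y x
    tri-adj   : ∀ {x y z} → Tri x y z → Adj x y
    tri-swap  : ∀ {x y z} → Tri x y z → Tri y x z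
    tri-rot   : ∀ {x y z} → Tri x y z → Tri y z x
    quad-tri  : ∀ {x y z w} → Quad x y z w → Tri x y z
    quad-rot  : ∀ {x y z w} → Quad x y z w → Quad y z w x
    no-B      : ∀ {v x y z w} → Tri v x y → Tri v z w → x ≢ z → x ≢ w → y ≢ z → y ≢ w → ¬ Adj y z

module Links {n : ℕ} (L : LinkSystem n) where
  open LinkSystem L

  tri-swap₂ : ∀ {x y z} → Tri x y z → Tri x z y
  tri-swap₂ t = tri-swap (tri-rot (tri-rot t))

  tri-adj₂ : ∀ {x y z} → Tri x y z → Adj y z
  tri-adj₂ t = tri-adj (tri-rot t)

  -- The end edges of the path are disjoint edges of the link of `v`, and the middle edge gives the
  -- face `y z` between them, as `no-B` forbids.
  link-P4-free : ∀ {v x y z w} → Tri v x y → Tri v y z → Tri v z w → x ≢ z → x ≢ w → y ≢ w → ⊥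
  link-P4-free t₁ t₂ t₃ x≢z x≢w y≢w = no-B t₁ t₃ x≢z x≢w (adj-irr (tri-adj₂ t₂)) y≢w (tri-adj₂ t₂)

  -- Heavy pairs, books and light triples

  codeg : Fin n → Fin n → ℕ
  codeg x y = sum λ z → ⟦ tri? x y z ⟧

  Heavy : Fin n → Fin n → Set
  Heavy x y = 3 ≤ codeg x y

  heavy? : ∀ x y → Dec (Heavy x y)
  heavy? x y = 3 ≤? codeg x y

  heavy-sym : ∀ {x y} → Heavy x y → Heavy y x
  heavy-sym {x} {y} h = ≤-trans h (sum-mono λ z → ⟦⟧-mono (tri? x y z) (tri? y x z) tri-swap)

  -- Otherwise a further page `w` of the spine `u z` gives the path `x`, `v`, `z`, `w` in the link
  -- of `u`. So the spine of a book is an isolated edge in the link of each of its pages.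
  heavy-unique : ∀ {v u z x} → Heavy u z → Tri v u z → Tri v u x → x ≡ z
  heavy-unique {v} {u} {z} {x} h t s with x ≟ z
  ... | yes p = p
  ... | no x≢z with third (tri? u z) h v x
  ...   | w , r , w≢v , w≢x =
    ⊥-elim (link-P4-free (tri-swap₂ (tri-swap s)) (tri-swap t) r x≢z (≢-sym w≢x) (≢-sym w≢v))

  heavy-excl : ∀ {v u z} → Heavy u z → Tri v u z → ¬ Heavy v u
  heavy-excl {v} {u} {z} h t h′ with third (tri? v u) h′ z z
  ... | w , s , w≢z , _ = w≢z (heavy-unique h t s)

  -- A triple contains at most one heavy pair: the triples through a heavy pair form a book with
  -- at least three pages, and Leaf v u z says that v is a page of the book with spine uz.
  Light : Fin n → Fin n → Fin n → Set
  Light x y z = Tri x y z × ¬ Heavy x y × ¬ Heavy x z × ¬ Heavy y z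

  light? : ∀ x y z → Dec (Light x y z)
  light? x y z = tri? x y z ×-dec ¬? (heavy? x y) ×-dec ¬? (heavy? x z) ×-dec ¬? (heavy? y z)

  Leaf : Fin n → Fin n → Fin n → Set
  Leaf v u z = Tri v u z × Heavy u z

  leaf? : ∀ v u z → Dec (Leaf v u z)
  leaf? v u z = tri? v u z ×-dec heavy? u z

  -- The two kinds of vertices that `v` charges: spine vertices of books with page `v`, and vertices
  -- sharing a light triple with `v`.
  F C : Fin n → Fin n → Set
  F v u = ∃ (Leaf v u)
  C v u = ∃ (Light v u)

  F? : ∀ v u → Dec (F v u)
  F? v u = any? (leaf? v u)

  C? : ∀ v u → Dec (C v u)
  C? v u = any? (light? v u)

  -- Lightness depends on the pair `v u` alone: if `v x` or `u x` were heavy, `heavy-unique` would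
  -- identify `x` with `u′`, making a pair of the given light triple heavy.
  C-light : ∀ {v u x} → C v u → Tri v u x → Light v u x
  C-light (u′ , t , ¬vu , ¬vu′ , ¬uu′) s = s , ¬vu
    , (λ h → ¬vu′ (subst (Heavy _) (sym (heavy-unique h (tri-swap s) (tri-swap t))) h))
    , (λ h → ¬uu′ (subst (Heavy _) (sym (heavy-unique h s t)) h))

  F-leaf : ∀ {v u x} → F v u → Tri v u x → Leaf v u x
  F-leaf (z , t , h) s with heavy-unique h t s
  ... | refl = s , h

  F-C-disjoint : ∀ {v u} → F v u → ¬ C v u
  F-C-disjoint (z , t , h) c = proj₂ (proj₂ (proj₂ (C-light c t))) h

  F-partner : ∀ {v u x} → Tri v u x → F v u → F v x
  F-partner {u = u} t f = u , tri-swap₂ t , heavy-sym (proj₂ (F-leaf f t))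

  C-partner : ∀ {v u x} → Tri v u x → C v u → C v x
  C-partner {u = u} t c with C-light c t
  ... | _ , ¬vu , ¬vx , ¬ux = u , tri-swap₂ t , ¬vx , ¬vu , ¬ux ∘ heavy-sym

  F-codeg : ∀ {v u} → F v u → codeg v u ≤ 1
  F-codeg {v} {u} (z , t , h) =
    count-unique (tri? v u) (λ x y p q → trans (heavy-unique h t p) (sym (heavy-unique h t q)))

  C-codeg : ∀ {v u} → C v u → codeg v u ≤ 2
  C-codeg (_ , _ , ¬vu , _) = ≤-pred (≰⇒> ¬vu)

  quad-tri₂ : ∀ {v u z w} → Quad v u z w → Tri v u w
  quad-tri₂ q = tri-rot (quad-tri (quad-rot (quad-rot (quad-rot q))))

  -- If a pair of the triple were heavy, the link of the third vertex would join one end of that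
  -- pair both to the other end and to the fourth vertex of the quadruple, against `heavy-unique`.
  quad-light : ∀ {v u z w} → Quad v u z w → Light v u z
  quad-light q = vuz
    , (λ h → u≢w (sym (heavy-unique h (tri-rot (tri-rot vuz)) (tri-swap₂ zwv))))
    , (λ h → z≢w (sym (heavy-unique h (tri-swap vuz) (tri-swap vuw))))
    , (λ h → z≢w (sym (heavy-unique h vuz vuw)))
    where
    vuz = quad-tri q
    vuw = quad-tri₂ q
    zwv = quad-tri (quad-rot (quad-rot q))
    z≢w = adj-irr (tri-adj zwv)
    u≢w = adj-irr (tri-adj₂ vuw)

  -- The unit is 1/12 of a face. A triple with a heavy pair is charged to its page v, split evenly
  -- between the two spine vertices. A light triple is charged evenly to its 6 ordered pairs and a
  -- quadruple to its 12; a pair then receives at most 2 + 2 + 1, strictly less than 6, and this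
  -- gap absorbs all losses caused by light triples.
  weight : Fin n → Fin n → ℕ
  weight v u = 6 * ⟦ F? v u ⟧ + 5 * ⟦ C? v u ⟧

  W : Fin n → ℕ
  W v = sum (weight v)

  -- When `C v u` holds, `u` has at most 2 neighbours in the link of `v`. This allows 2 light
  -- triples, and 2 ordered completions to a quadruple because `z` and `w` are distinct such
  -- neighbours; hence 4 * 2 + 2.
  light-quad-count : ∀ v u → 4 * sum (λ z → ⟦ light? v u z ⟧) + sum₂ (λ z w → ⟦ quad? v u z w ⟧) ≤ 10 * ⟦ C? v u ⟧
  light-quad-count v u with C? v u
  ... | yes c = +-mono-≤ {4 * sum (λ z → ⟦ light? v u z ⟧)} (*-monoʳ-≤ 4 (≤-trans lights (C-codeg c))) quads
    where
    open ≤-Reasoning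
    lights : sum (λ z → ⟦ light? v u z ⟧) ≤ codeg v u
    lights = sum-mono λ z → ⟦⟧-mono (light? v u z) (tri? v u z) proj₁
    others : ∀ z → Tri v u z → sum (λ w → ⟦ quad? v u z w ⟧) ≤ 1
    others z t = ≤-pred (begin
      suc (sum (λ w → ⟦ quad? v u z w ⟧))                         ≡⟨ cong (_+ sum (λ w → ⟦ quad? v u z w ⟧)) (sum-≟ z) ⟨
      sum (λ w → ⟦ w ≟ z ⟧) + sum (λ w → ⟦ quad? v u z w ⟧)       ≡⟨ ∑-distrib-+ (λ w → ⟦ w ≟ z ⟧) _ ⟨
      sum (λ w → ⟦ w ≟ z ⟧ + ⟦ quad? v u z w ⟧)                   ≤⟨ sum-mono pointwise ⟩
      codeg v u                                                   ≤⟨ C-codeg c ⟩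
      2                                                           ∎)
      where
      pointwise : ∀ w → ⟦ w ≟ z ⟧ + ⟦ quad? v u z w ⟧ ≤ ⟦ tri? v u w ⟧
      pointwise w with w ≟ z | quad? v u z w
      ... | yes refl | yes q = ⊥-elim (adj-irr (tri-adj (quad-tri (quad-rot (quad-rot q)))) refl)
      ... | yes refl | no _  = ⟦⟧-pos (tri? v u w) t
      ... | no _     | yes q = ⟦⟧-pos (tri? v u w) (quad-tri₂ q)
      ... | no _     | no _  = z≤n
    quads-at : ∀ z → sum (λ w → ⟦ quad? v u z w ⟧) ≤ ⟦ tri? v u z ⟧
    quads-at z with tri? v u z
    ... | yes t = others z t
    ... | no ¬t = ≤-reflexive (trans (sum-cong-≗ λ w → ⟦⟧-false (quad? v u z w) (¬t ∘ quad-tri)) (sum-zero n))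
    quads : sum₂ (λ z w → ⟦ quad? v u z w ⟧) ≤ 2
    quads = ≤-trans (sum-mono quads-at) (C-codeg c)
  ... | no ¬c = ≤-reflexive (cong₂ (λ a b → 4 * a + b)
    (trans (sum-cong-≗ λ z → ⟦⟧-false (light? v u z) (λ l → ¬c (z , l))) (sum-zero n))
    (trans (sum₂-cong λ z w → ⟦⟧-false (quad? v u z w) (λ q → ¬c (z , quad-light q)))
      (trans (sum-cong-≗ {n} λ _ → sum-zero n) (sum-zero n))))

  leaf-count : ∀ v u → sum (λ z → ⟦ leaf? v u z ⟧) ≤ ⟦ F? v u ⟧
  leaf-count v u with F? v u
  ... | yes f = ≤-trans (sum-mono λ z → ⟦⟧-mono (leaf? v u z) (tri? v u z) proj₁) (F-codeg f)
  ... | no ¬f = ≤-reflexive (trans (sum-cong-≗ λ z → ⟦⟧-false (leaf? v u z) (λ l → ¬f (z , l))) (sum-zero n))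

  tri-cases : ∀ v u z → ⟦ tri? v u z ⟧ ≤ ⟦ light? v u z ⟧ + (⟦ leaf? v u z ⟧ + (⟦ leaf? u v z ⟧ + ⟦ leaf? z v u ⟧))
  tri-cases v u z = ⟦⟧-≤ (tri? v u z) (cases (heavy? v u) (heavy? v z) (heavy? u z))
    where
    cases : Dec (Heavy v u) → Dec (Heavy v z) → Dec (Heavy u z) → Tri v u z →
            1 ≤ ⟦ light? v u z ⟧ + (⟦ leaf? v u z ⟧ + (⟦ leaf? u v z ⟧ + ⟦ leaf? z v u ⟧))
    cases (yes h) _ _ t = ≤-trans (⟦⟧-pos (leaf? z v u) (tri-rot (tri-rot t) , h))
      (m≤n⇒m≤o+n ⟦ light? v u z ⟧ (m≤n⇒m≤o+n ⟦ leaf? v u z ⟧ (m≤n+m _ ⟦ leaf? u v z ⟧)))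
    cases (no _) (yes h) _ t = ≤-trans (⟦⟧-pos (leaf? u v z) (tri-swap t , h))
      (m≤n⇒m≤o+n ⟦ light? v u z ⟧ (m≤n⇒m≤o+n ⟦ leaf? v u z ⟧ (m≤m+n _ _)))
    cases (no _) (no _) (yes h) t = ≤-trans (⟦⟧-pos (leaf? v u z) (t , h))
      (m≤n⇒m≤o+n ⟦ light? v u z ⟧ (m≤m+n _ _))
    cases (no a) (no b) (no c) t = ≤-trans (⟦⟧-pos (light? v u z) (t , a , b , c)) (m≤m+n _ _)

  -- In a complex, ordered tuples count each triple 6 times and each quadruple 24 times, so the left
  -- side is 24 times the number of these faces, matching twice the weight in units of 1/12.
  charging : 4 * sum₃ (λ v u z → ⟦ tri? v u z ⟧) + sum₂ (λ v u → sum₂ λ z w → ⟦ quad? v u z w ⟧) ≤ 2 * sum W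
  charging = begin
    4 * sum₃ (λ v u z → ⟦ tri? v u z ⟧) + D
      ≤⟨ +-monoˡ-≤ D (*-monoʳ-≤ 4 (sum₃-mono tri-cases)) ⟩
    4 * sum₃ (λ v u z → ⟦ light? v u z ⟧ + (⟦ leaf? v u z ⟧ + (⟦ leaf? u v z ⟧ + ⟦ leaf? z v u ⟧))) + D
      ≡⟨ cong (λ s → 4 * s + D) split ⟩
    4 * (A + (B + (B + B))) + D
      ≡⟨ regroup A B D ⟩
    (4 * A + D) + 12 * B
      ≤⟨ +-mono-≤ cheap (*-monoʳ-≤ 12 (sum₂-mono leaf-count)) ⟩
    10 * sum₂ (λ v u → ⟦ C? v u ⟧) + 12 * sum₂ (λ v u → ⟦ F? v u ⟧)
      ≡⟨ regroup₂ (sum₂ (λ v u → ⟦ C? v u ⟧)) (sum₂ (λ v u → ⟦ F? v u ⟧)) ⟩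
    2 * (6 * sum₂ (λ v u → ⟦ F? v u ⟧) + 5 * sum₂ (λ v u → ⟦ C? v u ⟧))
      ≡⟨ cong (2 *_) (cong₂ _+_ (sum₂-* 6 (λ v u → ⟦ F? v u ⟧)) (sum₂-* 5 (λ v u → ⟦ C? v u ⟧))) ⟨
    2 * (sum₂ (λ v u → 6 * ⟦ F? v u ⟧) + sum₂ (λ v u → 5 * ⟦ C? v u ⟧))
      ≡⟨ cong (2 *_) (sum₂-+ (λ v u → 6 * ⟦ F? v u ⟧) _) ⟨
    2 * sum W ∎
    where
    open ≤-Reasoning
    A B D : ℕ
    A = sum₃ (λ v u z → ⟦ light? v u z ⟧)
    B = sum₃ (λ v u z → ⟦ leaf? v u z ⟧)
    D = sum₂ (λ v u → sum₂ λ z w → ⟦ quad? v u z w ⟧)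
    split : sum₃ (λ v u z → ⟦ light? v u z ⟧ + (⟦ leaf? v u z ⟧ + (⟦ leaf? u v z ⟧ + ⟦ leaf? z v u ⟧))) ≡ A + (B + (B + B))
    -- Permuting the summation variables shows that the three possible positions of the page
    -- contribute equally.
    split = trans (sum₃-+ (λ v u z → ⟦ light? v u z ⟧) _) (cong (A +_)
      (trans (sum₃-+ (λ v u z → ⟦ leaf? v u z ⟧) _) (cong (B +_)
      (trans (sum₃-+ (λ v u z → ⟦ leaf? u v z ⟧) _) (cong₂ _+_
        (∑-comm (λ v u → sum (λ z → ⟦ leaf? u v z ⟧)))
        (trans (sum-cong-≗ λ v → ∑-comm (λ u z → ⟦ leaf? z v u ⟧)) (∑-comm (λ v z → sum (λ u → ⟦ leaf? z v u ⟧)))))))))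
    regroup : ∀ a b q → 4 * (a + (b + (b + b))) + q ≡ (4 * a + q) + 12 * b
    regroup = solve-∀
    regroup₂ : ∀ c f → 10 * c + 12 * f ≡ 2 * (6 * f + 5 * c)
    regroup₂ = solve-∀
    cheap : 4 * A + D ≤ 10 * sum₂ (λ v u → ⟦ C? v u ⟧)
    cheap = begin
      4 * A + D
        ≡⟨ cong (_+ D) (sum₂-* 4 (λ v u → sum (λ z → ⟦ light? v u z ⟧))) ⟨
      sum₂ (λ v u → 4 * sum (λ z → ⟦ light? v u z ⟧)) + D
        ≡⟨ sum₂-+ (λ v u → 4 * sum (λ z → ⟦ light? v u z ⟧)) _ ⟨
      sum₂ (λ v u → 4 * sum (λ z → ⟦ light? v u z ⟧) + sum₂ (λ z w → ⟦ quad? v u z w ⟧))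
        ≤⟨ sum₂-mono light-quad-count ⟩
      sum₂ (λ v u → 10 * ⟦ C? v u ⟧)
        ≡⟨ sum₂-* 10 (λ v u → ⟦ C? v u ⟧) ⟩
      10 * sum₂ (λ v u → ⟦ C? v u ⟧) ∎

  -- Missing pairs forced by the charges

  Miss : Fin n → Fin n → Set
  Miss x y = x ≢ y × ¬ Adj x y

  miss? : ∀ x y → Dec (Miss x y)
  miss? x y = ¬? (x ≟ y) ×-dec ¬? (adj? x y)

  miss-sym : ∀ {x y} → Miss x y → Miss y x
  miss-sym (x≢y , ¬a) = ≢-sym x≢y , ¬a ∘ adj-sym

  S : Fin n → Fin n → Set
  S v u = F v u ⊎ C v u

  S-tri : ∀ {v u} → S v u → ∃ λ z → Tri v u z × (Heavy u z ⊎ Light v u z)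
  S-tri (inj₁ (z , t , h)) = z , t , inj₁ h
  S-tri (inj₂ (z , l))     = z , proj₁ l , inj₂ l

  S-adj : ∀ {v u} → S v u → Adj v u
  S-adj s = tri-adj (proj₁ (proj₂ (S-tri s)))

  -- `F` and `C` are disjoint, so a pair carries at most 6. It remains only to exhibit one unit of
  -- payment for each `u` in `S a`.
  weight-≤ : ∀ a u {k} → (S a u → 1 ≤ k) → weight a u ≤ 6 * k
  weight-≤ a u h with F? a u | C? a u
  ... | yes f | yes c = contradiction c (F-C-disjoint f)
  ... | yes f | no _  = *-monoʳ-≤ 6 (h (inj₁ f))
  ... | no _  | yes c = ≤-trans (n≤1+n 5) (*-monoʳ-≤ 6 (h (inj₂ c)))
  ... | no _  | no _  = z≤n

  module Neighbourhood (v : Fin n) where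

    Far : Fin n → Fin n → Set
    Far a′ u = ¬ S v u × Miss a′ u

    -- If `u u′` and `v a′` do not meet, they are disjoint edges in the link of `a`. Then `no-B`
    -- makes `u` nonadjacent to `a′` and also to `v`, which rules out `S v u`.
    far-or-meet : ∀ {a a′ u u′} → Tri v a a′ → Tri a u u′ →
                  Far a′ u ⊎ (u ≡ v ⊎ u ≡ a′ ⊎ u′ ≡ v ⊎ u′ ≡ a′)
    far-or-meet {a} {a′} {u} {u′} t s with u ≟ v | u ≟ a′ | u′ ≟ v | u′ ≟ a′
    ... | yes p | _ | _ | _ = inj₂ (inj₁ p)
    ... | no _ | yes p | _ | _ = inj₂ (inj₂ (inj₁ p))
    ... | no _ | no _ | yes p | _ = inj₂ (inj₂ (inj₂ (inj₁ p)))
    ... | no _ | no _ | no _ | yes p = inj₂ (inj₂ (inj₂ (inj₂ p)))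
    ... | no u≢v | no u≢a′ | no u′≢v | no u′≢a′ = inj₁
      ( (λ vu → no-B (tri-swap₂ s) (tri-swap t) u′≢v u′≢a′ u≢v u≢a′ (adj-sym (S-adj vu)))
      , ≢-sym u≢a′
      , (λ a → no-B (tri-swap₂ s) (tri-rot t) u′≢a′ u′≢v u≢a′ u≢v (adj-sym a)))

    -- Here `a a′` is heavy. In each exceptional case of `far-or-meet` the triple `a u u′` contains
    -- `a a′`, by `heavy-unique` when it meets `v`; but a triple containing a heavy pair at `a` is
    -- neither light nor a page `a` on its spine.
    F-far : ∀ {a a′ u} → F v a → Tri v a a′ → S a u → Far a′ u
    F-far {a} {a′} f t au with S-tri au | F-leaf f t
    ... | u′ , s , ty | _ , h with far-or-meet t s
    ...   | inj₁ far = far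
    ...   | inj₂ (inj₂ (inj₁ refl)) = ⊥-elim (off-spine s ty)
      where
      off-spine : ∀ {x} → Tri a a′ x → ¬ (Heavy a′ x ⊎ Light a a′ x)
      off-spine s (inj₁ h′) = heavy-excl h′ s h
      off-spine s (inj₂ (_ , ¬h , _)) = ¬h h
    ...   | inj₂ (inj₂ (inj₂ (inj₂ refl))) = ⊥-elim (off-leaf s ty)
      where
      off-leaf : ∀ {x} → Tri a x a′ → ¬ (Heavy x a′ ⊎ Light a x a′)
      off-leaf s (inj₁ h′) = heavy-excl (heavy-sym h′) (tri-swap₂ s) h
      off-leaf s (inj₂ (_ , _ , ¬h , _)) = ¬h h
    ...   | inj₂ (inj₁ refl) with heavy-unique h t (tri-swap s)
    F-far f t au | u′ , s , ty | _ , h | inj₂ (inj₁ refl) | refl with ty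
    ... | inj₁ h′ = ⊥-elim (heavy-excl (heavy-sym h′) (tri-swap₂ s) h)
    ... | inj₂ (_ , _ , ¬h , _) = ⊥-elim (¬h h)
    F-far f t au | u′ , s , ty | _ , h | inj₂ (inj₂ (inj₂ (inj₁ refl))) with heavy-unique h t (tri-rot (tri-rot s))
    ... | refl with ty
    ...   | inj₁ h′ = ⊥-elim (heavy-excl h′ s h)
    ...   | inj₂ (_ , ¬h , _) = ⊥-elim (¬h h)

    -- Without heaviness the exceptions remain, but in this form codegree bounds limit their number.
    C-far : ∀ {a a′ u} → Tri v a a′ → S a u → Far a′ u ⊎ (u ≡ v ⊎ Tri v a u ⊎ Tri a a′ u)
    C-far t au with S-tri au
    ... | u′ , s , _ with far-or-meet t s
    ...   | inj₁ far = inj₁ far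
    ...   | inj₂ (inj₁ u≡v) = inj₂ (inj₁ u≡v)
    ...   | inj₂ (inj₂ (inj₁ refl)) = inj₂ (inj₂ (inj₁ t))
    ...   | inj₂ (inj₂ (inj₂ (inj₁ refl))) = inj₂ (inj₂ (inj₁ (tri-rot (tri-rot s))))
    ...   | inj₂ (inj₂ (inj₂ (inj₂ refl))) = inj₂ (inj₂ (inj₂ (tri-swap₂ s)))

    -- If link edges at `x` and `y` were disjoint, `no-B` would exclude the adjacency. So either
    -- `x y` is itself a link edge or the two share a partner; the latter needs `C v x`, since the
    -- partner of a spine vertex has only one link neighbour.
    adj-in-S : ∀ {x y} → S v x → S v y → Adj x y →
               Tri v x y ⊎ (C v x × ∃ λ x′ → Tri v x x′ × Tri v x′ y)
    adj-in-S {x} {y} sx sy xy with S-tri sx | S-tri sy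
    ... | x′ , t , _ | y′ , s , _ with y ≟ x′ | y′ ≟ x | y′ ≟ x′
    ...   | yes refl | _ | _ = inj₁ t
    ...   | no _ | yes refl | _ = inj₁ (tri-swap₂ s)
    ...   | no y≢x′ | no y′≢x | no y′≢x′ =
      ⊥-elim (no-B (tri-swap₂ t) s (≢-sym y≢x′) (≢-sym y′≢x′) (adj-irr xy) (≢-sym y′≢x) xy)
    ...   | no _ | no _ | yes refl with sx
    ...     | inj₂ c = inj₂ (c , x′ , t , tri-swap₂ s)
    ...     | inj₁ f with F-partner t f
    ...       | _ , r , h = ⊥-elim (adj-irr xy
      (trans (heavy-unique h r (tri-swap₂ t)) (sym (heavy-unique h r (tri-swap₂ s)))))

    -- Counting missing pairs around the neighbourhood

    φ γ σ ρ : Fin n → ℕ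
    φ u = ⟦ F? v u ⟧
    γ u = ⟦ C? v u ⟧
    σ u = φ u + γ u
    ρ u = ⟦ ¬? (F? v u ⊎-dec C? v u) ⟧

    σ+ρ≡1 : ∀ u → σ u + ρ u ≡ 1
    σ+ρ≡1 u with F? v u | C? v u
    ... | yes f | yes c = contradiction c (F-C-disjoint f)
    ... | yes _ | no _  = refl
    ... | no _  | yes _ = refl
    ... | no _  | no _  = refl

    ρ-pos : ∀ u → ¬ S v u → 1 ≤ ρ u
    ρ-pos u = ⟦⟧-pos (¬? (F? v u ⊎-dec C? v u))

    σ≤1 : ∀ u → σ u ≤ 1
    σ≤1 u = ≤-trans (m≤m+n _ (ρ u)) (≤-reflexive (σ+ρ≡1 u))

    σ*-mono : ∀ u {m k} → (S v u → m ≤ k) → σ u * m ≤ σ u * k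
    σ*-mono u {m} {k} h = begin
      σ u * m             ≡⟨ *-distribʳ-+ m (φ u) (γ u) ⟩
      φ u * m + γ u * m   ≤⟨ +-mono-≤ (⟦⟧*-mono (F? v u) (h ∘ inj₁)) (⟦⟧*-mono (C? v u) (h ∘ inj₂)) ⟩
      φ u * k + γ u * k   ≡⟨ *-distribʳ-+ k (φ u) (γ u) ⟨
      σ u * k             ∎
      where open ≤-Reasoning

    σ*-≤ : ∀ u {m k} → (S v u → m ≤ k) → σ u * m ≤ k
    σ*-≤ u {k = k} h = ≤-trans (σ*-mono u h) (≤-trans (*-monoˡ-≤ k (σ≤1 u)) (≤-reflexive (*-identityˡ k)))

    -- `r`, `f` and `c` are the sizes of the complement of `S v`, of `F v` and of `C v`. `X` counts
    -- each missing pair between `S v` and its complement once, whereas `Y` and `M` count ordered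
    -- missing pairs, inside `S v` and in total.
    r f c X Y M : ℕ
    r = sum ρ
    f = sum φ
    c = sum γ
    X = sum₂ λ x u → σ x * (ρ u * ⟦ miss? x u ⟧)
    Y = sum₂ λ x y → σ x * (σ y * ⟦ miss? x y ⟧)
    M = sum₂ λ x y → ⟦ miss? x y ⟧

    sum-σ : sum σ ≡ f + c
    sum-σ = ∑-distrib-+ φ γ

    partition : (f + c) + r ≡ n
    partition = begin
      (f + c) + r           ≡⟨ cong (_+ r) sum-σ ⟨
      sum σ + r             ≡⟨ ∑-distrib-+ σ ρ ⟨
      sum (λ u → σ u + ρ u) ≡⟨ sum-cong-≗ σ+ρ≡1 ⟩
      sum {n} (λ _ → 1)     ≡⟨ sum-const n 1 ⟩
      n * 1                 ≡⟨ *-identityʳ n ⟩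
      n                     ∎
      where open ≡-Reasoning

    W-v : W v ≡ 6 * f + 5 * c
    W-v = trans (∑-distrib-+ (λ u → 6 * φ u) _)
      (sym (cong₂ _+_ (*-distribˡ-sum 6 φ) (*-distribˡ-sum 5 γ)))

    -- Crossing missing pairs occur in both orders in `M`; missing pairs outside `S v` are dropped.
    miss-count : Y + 2 * X ≤ M
    miss-count = begin
      Y + 2 * X
        ≡⟨ cong (λ s → Y + (X + s)) (trans (+-identityʳ X) X-swap) ⟩
      Y + (X + X′)
        ≡⟨ trans (sum₂-+ (λ x y → σ x * (σ y * μ x y)) _) (cong (Y +_) (sum₂-+ (λ x y → σ x * (ρ y * μ x y)) _)) ⟨
      sum₂ (λ x y → σ x * (σ y * μ x y) + (σ x * (ρ y * μ x y) + ρ x * (σ y * μ x y)))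
        ≤⟨ sum₂-mono pointwise ⟩
      M ∎
      where
      open ≤-Reasoning
      μ : Fin n → Fin n → ℕ
      μ x y = ⟦ miss? x y ⟧
      X′ : ℕ
      X′ = sum₂ λ x y → ρ x * (σ y * μ x y)
      μ-sym : ∀ x y → μ x y ≡ μ y x
      μ-sym x y = ≤-antisym (⟦⟧-mono (miss? x y) (miss? y x) miss-sym) (⟦⟧-mono (miss? y x) (miss? x y) miss-sym)
      X-swap : X ≡ X′
      X-swap = trans (∑-comm (λ x y → σ x * (ρ y * μ x y)))
        (sum₂-cong λ y x → trans (x∙yz≈y∙xz (σ x) (ρ y) _) (cong (λ m → ρ y * (σ x * m)) (μ-sym x y)))
      expand : ∀ a b a′ b′ m → a * (b * m) + (a * (b′ * m) + a′ * (b * m)) + a′ * (b′ * m) ≡ (a + a′) * ((b + b′) * m)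
      expand = solve-∀
      pointwise : ∀ x y → σ x * (σ y * μ x y) + (σ x * (ρ y * μ x y) + ρ x * (σ y * μ x y)) ≤ μ x y
      pointwise x y = begin
        σ x * (σ y * μ x y) + (σ x * (ρ y * μ x y) + ρ x * (σ y * μ x y))
          ≤⟨ m≤m+n _ (ρ x * (ρ y * μ x y)) ⟩
        σ x * (σ y * μ x y) + (σ x * (ρ y * μ x y) + ρ x * (σ y * μ x y)) + ρ x * (ρ y * μ x y)
          ≡⟨ expand (σ x) (σ y) (ρ x) (ρ y) (μ x y) ⟩
        (σ x + ρ x) * ((σ y + ρ y) * μ x y)
          ≡⟨ cong₂ (λ a b → a * (b * μ x y)) (σ+ρ≡1 x) (σ+ρ≡1 y) ⟩
        1 * (1 * μ x y)
          ≡⟨ trans (*-identityˡ _) (*-identityˡ _) ⟩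
        μ x y ∎

    degree-in-S : Fin n → ℕ
    degree-in-S x = sum λ y → σ y * ⟦ adj? x y ⟧

    F-degree : ∀ x → F v x → degree-in-S x ≤ 1
    F-degree x fx = ≤-trans (sum-mono λ y → σ*-≤ y λ sy → ⟦⟧-mono (adj? x y) (tri? v x y) (only sy)) (F-codeg fx)
      where
      only : ∀ {y} → S v y → Adj x y → Tri v x y
      only sy xy with adj-in-S (inj₁ fx) sy xy
      ... | inj₁ t = t
      ... | inj₂ (cx , _) = contradiction cx (F-C-disjoint fx)

    -- By `adj-in-S`, a neighbour of `x` in `S v` is within two steps of `x` in the link of `v`,
    -- where the degrees concerned are at most 2. This gives 2 + 2 * 2.
    C-degree : ∀ x → C v x → degree-in-S x ≤ 6
    C-degree x cx = begin
      degree-in-S x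
        ≤⟨ sum-mono (λ y → σ*-≤ y λ sy → ⟦⟧-≤ (adj? x y) (cover y sy)) ⟩
      sum (λ y → ⟦ tri? v x y ⟧ + sum (λ x′ → ⟦ tri? v x x′ ⟧ * ⟦ tri? v x′ y ⟧))
        ≡⟨ ∑-distrib-+ (λ y → ⟦ tri? v x y ⟧) _ ⟩
      codeg v x + sum (λ y → sum (λ x′ → ⟦ tri? v x x′ ⟧ * ⟦ tri? v x′ y ⟧))
        ≡⟨ cong (codeg v x +_) (trans (∑-comm (λ y x′ → ⟦ tri? v x x′ ⟧ * ⟦ tri? v x′ y ⟧))
             (sum-cong-≗ λ x′ → sym (*-distribˡ-sum ⟦ tri? v x x′ ⟧ (λ y → ⟦ tri? v x′ y ⟧)))) ⟩
      codeg v x + sum (λ x′ → ⟦ tri? v x x′ ⟧ * codeg v x′)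
        ≤⟨ +-monoʳ-≤ (codeg v x) (sum-mono λ x′ → ⟦⟧*-mono (tri? v x x′) (λ t → C-codeg (C-partner t cx))) ⟩
      codeg v x + sum (λ x′ → ⟦ tri? v x x′ ⟧ * 2)
        ≡⟨ cong (codeg v x +_) (*-distribʳ-sum 2 (λ x′ → ⟦ tri? v x x′ ⟧)) ⟨
      codeg v x + codeg v x * 2
        ≤⟨ +-mono-≤ (C-codeg cx) (*-monoˡ-≤ 2 (C-codeg cx)) ⟩
      6 ∎
      where
      open ≤-Reasoning
      cover : ∀ y → S v y → Adj x y → 1 ≤ ⟦ tri? v x y ⟧ + sum (λ x′ → ⟦ tri? v x x′ ⟧ * ⟦ tri? v x′ y ⟧)
      cover y sy xy with adj-in-S (inj₂ cx) sy xy
      ... | inj₁ t = m≤n⇒m≤n+o _ (⟦⟧-pos (tri? v x y) t)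
      ... | inj₂ (_ , x′ , t , t′) = m≤n⇒m≤o+n ⟦ tri? v x y ⟧
        (≤-trans (*-mono-≤ (⟦⟧-pos (tri? v x x′) t) (⟦⟧-pos (tri? v x′ y) t′))
                 (term≤sum (λ x′ → ⟦ tri? v x x′ ⟧ * ⟦ tri? v x′ y ⟧) x′))

    -- An ordered pair inside `S v` is missing, diagonal or adjacent; the degree bounds 1 on `F v`
    -- and 6 on `C v` control the adjacent ones.
    square-bound : (f + c) * (f + c) ≤ Y + ((f + c) + (f + 6 * c))
    square-bound = begin
      (f + c) * (f + c)
        ≡⟨ cong₂ _*_ sum-σ sum-σ ⟨
      sum σ * sum σ
        ≡⟨ sum₂-product σ σ ⟨
      sum₂ (λ x y → σ x * σ y)
        ≤⟨ sum₂-mono pointwise ⟩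
      sum₂ (λ x y → σ x * (σ y * ⟦ miss? x y ⟧) + (σ x * ⟦ y ≟ x ⟧ + σ x * (σ y * ⟦ adj? x y ⟧)))
        ≡⟨ trans (sum₂-+ (λ x y → σ x * (σ y * ⟦ miss? x y ⟧)) _) (cong (Y +_) (sum₂-+ (λ x y → σ x * ⟦ y ≟ x ⟧) _)) ⟩
      Y + (sum₂ (λ x y → σ x * ⟦ y ≟ x ⟧) + sum₂ (λ x y → σ x * (σ y * ⟦ adj? x y ⟧)))
        ≤⟨ +-monoʳ-≤ Y (+-mono-≤ (≤-reflexive diagonal) degrees) ⟩
      Y + ((f + c) + (f + 6 * c)) ∎
      where
      open ≤-Reasoning
      expand : ∀ a b d e → a * (b * (d + e)) ≡ a * (b * d) + a * (b * e)
      expand = solve-∀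
      cover : ∀ x y → x ≢ y → 1 ≤ ⟦ miss? x y ⟧ + ⟦ adj? x y ⟧
      cover x y x≢y = cases (adj? x y)
        where
        cases : Dec (Adj x y) → 1 ≤ ⟦ miss? x y ⟧ + ⟦ adj? x y ⟧
        cases (yes a) = m≤n⇒m≤o+n ⟦ miss? x y ⟧ (⟦⟧-pos (adj? x y) a)
        cases (no ¬a) = m≤n⇒m≤n+o _ (⟦⟧-pos (miss? x y) (x≢y , ¬a))
      pointwise : ∀ x y → σ x * σ y ≤ σ x * (σ y * ⟦ miss? x y ⟧) + (σ x * ⟦ y ≟ x ⟧ + σ x * (σ y * ⟦ adj? x y ⟧))
      pointwise x y = cases (y ≟ x)
        where
        cases : Dec (y ≡ x) → σ x * σ y ≤ σ x * (σ y * ⟦ miss? x y ⟧) + (σ x * ⟦ y ≟ x ⟧ + σ x * (σ y * ⟦ adj? x y ⟧))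
        cases (yes p) = m≤n⇒m≤o+n (σ x * (σ y * ⟦ miss? x y ⟧)) (m≤n⇒m≤n+o _
          (*-monoʳ-≤ (σ x) (≤-trans (σ≤1 y) (⟦⟧-pos (y ≟ x) p))))
        cases (no y≢x) = begin
          σ x * σ y
            ≡⟨ cong (σ x *_) (*-identityʳ (σ y)) ⟨
          σ x * (σ y * 1)
            ≤⟨ *-monoʳ-≤ (σ x) (*-monoʳ-≤ (σ y) (cover x y (≢-sym y≢x))) ⟩
          σ x * (σ y * (⟦ miss? x y ⟧ + ⟦ adj? x y ⟧))
            ≡⟨ expand (σ x) (σ y) _ _ ⟩
          σ x * (σ y * ⟦ miss? x y ⟧) + σ x * (σ y * ⟦ adj? x y ⟧)
            ≤⟨ +-monoʳ-≤ (σ x * (σ y * ⟦ miss? x y ⟧)) (m≤n+m _ (σ x * ⟦ y ≟ x ⟧)) ⟩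
          σ x * (σ y * ⟦ miss? x y ⟧) + (σ x * ⟦ y ≟ x ⟧ + σ x * (σ y * ⟦ adj? x y ⟧)) ∎
      diagonal : sum₂ (λ x y → σ x * ⟦ y ≟ x ⟧) ≡ f + c
      diagonal = trans (sum-cong-≗ λ x → trans (sym (*-distribˡ-sum (σ x) (λ y → ⟦ y ≟ x ⟧)))
        (trans (cong (σ x *_) (sum-≟ x)) (*-identityʳ (σ x)))) sum-σ
      degrees : sum₂ (λ x y → σ x * (σ y * ⟦ adj? x y ⟧)) ≤ f + 6 * c
      degrees = begin
        sum₂ (λ x y → σ x * (σ y * ⟦ adj? x y ⟧))
          ≡⟨ sum-cong-≗ (λ x → *-distribˡ-sum (σ x) (λ y → σ y * ⟦ adj? x y ⟧)) ⟨
        sum (λ x → σ x * degree-in-S x)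
          ≤⟨ sum-mono (λ x → ≤-trans (≤-reflexive (*-distribʳ-+ (degree-in-S x) (φ x) (γ x)))
               (+-mono-≤ (⟦⟧*-mono (F? v x) (F-degree x)) (⟦⟧*-mono (C? v x) (C-degree x)))) ⟩
        sum (λ x → φ x * 1 + γ x * 6)
          ≡⟨ sum-cong-≗ (λ x → cong₂ _+_ (*-identityʳ (φ x)) (*-comm (γ x) 6)) ⟩
        sum (λ x → φ x + 6 * γ x)
          ≡⟨ ∑-distrib-+ φ _ ⟩
        f + sum (λ x → 6 * γ x)
          ≡⟨ cong (f +_) (*-distribˡ-sum 6 γ) ⟨
        f + 6 * c ∎

    -- Paying for the weight inside the neighbourhood

    -- The missing pairs available to pay for `W a`: those from link partners of `a` to vertices
    -- outside `S v`.
    farPairs : Fin n → ℕ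
    farPairs a = sum₂ λ a′ u → ⟦ tri? v a a′ ⟧ * (ρ u * ⟦ miss? a′ u ⟧)

    farPairs-≥ : ∀ {a a′} → Tri v a a′ → sum (λ u → ρ u * ⟦ miss? a′ u ⟧) ≤ farPairs a
    farPairs-≥ {a} {a′} t = ≤-trans
      (sum-mono λ u → ≤-trans (≤-reflexive (sym (*-identityˡ _))) (*-monoˡ-≤ (ρ u * ⟦ miss? a′ u ⟧) (⟦⟧-pos (tri? v a a′) t)))
      (term≤sum (λ a′ → sum λ u → ⟦ tri? v a a′ ⟧ * (ρ u * ⟦ miss? a′ u ⟧)) a′)

    far-pos : ∀ a′ u → Far a′ u → 1 ≤ ρ u * ⟦ miss? a′ u ⟧
    far-pos a′ u (¬s , m) = *-mono-≤ (ρ-pos u ¬s) (⟦⟧-pos (miss? a′ u) m)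

    F-W : ∀ a → F v a → W a ≤ 6 * farPairs a
    F-W a fa@(a′ , t , _) = begin
      W a                                            ≤⟨ sum-mono (λ u → weight-≤ a u (far-pos a′ u ∘ F-far fa t)) ⟩
      sum (λ u → 6 * (ρ u * ⟦ miss? a′ u ⟧))          ≡⟨ *-distribˡ-sum 6 (λ u → ρ u * ⟦ miss? a′ u ⟧) ⟨
      6 * sum (λ u → ρ u * ⟦ miss? a′ u ⟧)            ≤⟨ *-monoʳ-≤ 6 (farPairs-≥ t) ⟩
      6 * farPairs a                                 ∎
      where open ≤-Reasoning

    -- At most 1 + 2 + 2 vertices escape being far: `v`, the neighbours of `a` in the link of `v`,
    -- and the third vertices of triples on `a a′`. Each weighs at most 6, whence 30.
    C-W : ∀ a → C v a → W a ≤ 6 * farPairs a + 30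
    C-W a ca@(a′ , t , _ , _ , ¬aa′) = begin
      W a
        ≤⟨ sum-mono (λ u → weight-≤ a u (cover u)) ⟩
      sum (λ u → 6 * (ρ u * ⟦ miss? a′ u ⟧ + near u))
        ≡⟨ *-distribˡ-sum 6 (λ u → ρ u * ⟦ miss? a′ u ⟧ + near u) ⟨
      6 * sum (λ u → ρ u * ⟦ miss? a′ u ⟧ + near u)
        ≡⟨ cong (6 *_) (∑-distrib-+ (λ u → ρ u * ⟦ miss? a′ u ⟧) near) ⟩
      6 * (sum (λ u → ρ u * ⟦ miss? a′ u ⟧) + sum near)
        ≤⟨ *-monoʳ-≤ 6 (+-mono-≤ (farPairs-≥ t) near≤5) ⟩
      6 * (farPairs a + 5)
        ≡⟨ *-distribˡ-+ 6 (farPairs a) 5 ⟩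
      6 * farPairs a + 30 ∎
      where
      open ≤-Reasoning
      near : Fin n → ℕ
      near u = ⟦ u ≟ v ⟧ + (⟦ tri? v a u ⟧ + ⟦ tri? a a′ u ⟧)
      near≤5 : sum near ≤ 5
      near≤5 = begin
        sum near
          ≡⟨ trans (∑-distrib-+ (λ u → ⟦ u ≟ v ⟧) _) (cong₂ _+_ (sum-≟ v) (∑-distrib-+ (λ u → ⟦ tri? v a u ⟧) _)) ⟩
        1 + (codeg v a + codeg a a′)
          ≤⟨ +-monoʳ-≤ 1 (+-mono-≤ (C-codeg ca) (≤-pred (≰⇒> ¬aa′))) ⟩
        5 ∎
      cover : ∀ u → S a u → 1 ≤ ρ u * ⟦ miss? a′ u ⟧ + near u
      cover u au with C-far t au
      ... | inj₁ far = m≤n⇒m≤n+o _ (far-pos a′ u far)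
      ... | inj₂ (inj₁ p) = m≤n⇒m≤o+n (ρ u * ⟦ miss? a′ u ⟧) (m≤n⇒m≤n+o _ (⟦⟧-pos (u ≟ v) p))
      ... | inj₂ (inj₂ (inj₁ p)) = m≤n⇒m≤o+n (ρ u * ⟦ miss? a′ u ⟧) (m≤n⇒m≤o+n ⟦ u ≟ v ⟧
        (m≤n⇒m≤n+o _ (⟦⟧-pos (tri? v a u) p)))
      ... | inj₂ (inj₂ (inj₂ p)) = m≤n⇒m≤o+n (ρ u * ⟦ miss? a′ u ⟧) (m≤n⇒m≤o+n ⟦ u ≟ v ⟧
        (m≤n⇒m≤o+n ⟦ tri? v a u ⟧ (⟦⟧-pos (tri? a a′ u) p)))

    -- Regrouped by the partner `a′`, which also lies in `S v` and is a partner of at most 2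
    -- vertices, the sum meets each missing pair of `X` at most twice.
    farPairs-total : sum (λ a → σ a * farPairs a) ≤ 2 * X
    farPairs-total = begin
      sum (λ a → σ a * farPairs a)
        ≡⟨ sum-cong-≗ (λ a → sum₂-* (σ a) (λ a′ u → ⟦ tri? v a a′ ⟧ * (ρ u * ⟦ miss? a′ u ⟧))) ⟨
      sum₃ (λ a a′ u → σ a * (⟦ tri? v a a′ ⟧ * (ρ u * ⟦ miss? a′ u ⟧)))
        ≤⟨ sum₃-mono transfer ⟩
      sum₃ (λ a a′ u → ⟦ tri? v a′ a ⟧ * (σ a′ * (ρ u * ⟦ miss? a′ u ⟧)))
        ≡⟨ ∑-comm (λ a a′ → sum λ u → ⟦ tri? v a′ a ⟧ * (σ a′ * (ρ u * ⟦ miss? a′ u ⟧))) ⟩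
      sum₃ (λ a′ a u → ⟦ tri? v a′ a ⟧ * (σ a′ * (ρ u * ⟦ miss? a′ u ⟧)))
        ≡⟨ sum-cong-≗ (λ a′ → sum₂-product (λ a → ⟦ tri? v a′ a ⟧) (λ u → σ a′ * (ρ u * ⟦ miss? a′ u ⟧))) ⟩
      sum (λ a′ → codeg v a′ * sum (λ u → σ a′ * (ρ u * ⟦ miss? a′ u ⟧)))
        ≤⟨ sum-mono bounded ⟩
      sum (λ a′ → 2 * sum (λ u → σ a′ * (ρ u * ⟦ miss? a′ u ⟧)))
        ≡⟨ *-distribˡ-sum 2 (λ a′ → sum (λ u → σ a′ * (ρ u * ⟦ miss? a′ u ⟧))) ⟨
      2 * X ∎
      where
      open ≤-Reasoning
      σ-mono : ∀ {a a′} → Tri v a a′ → σ a ≤ σ a′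
      σ-mono {a} {a′} t = +-mono-≤ (⟦⟧-mono (F? v a) (F? v a′) (F-partner t)) (⟦⟧-mono (C? v a) (C? v a′) (C-partner t))
      transfer : ∀ a a′ u → σ a * (⟦ tri? v a a′ ⟧ * (ρ u * ⟦ miss? a′ u ⟧)) ≤ ⟦ tri? v a′ a ⟧ * (σ a′ * (ρ u * ⟦ miss? a′ u ⟧))
      transfer a a′ u = begin
        σ a * (⟦ tri? v a a′ ⟧ * (ρ u * ⟦ miss? a′ u ⟧))
          ≡⟨ x∙yz≈y∙xz (σ a) ⟦ tri? v a a′ ⟧ _ ⟩
        ⟦ tri? v a a′ ⟧ * (σ a * (ρ u * ⟦ miss? a′ u ⟧))
          ≤⟨ ⟦⟧*-mono (tri? v a a′) (λ t → *-monoˡ-≤ (ρ u * ⟦ miss? a′ u ⟧) (σ-mono t)) ⟩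
        ⟦ tri? v a a′ ⟧ * (σ a′ * (ρ u * ⟦ miss? a′ u ⟧))
          ≤⟨ *-monoˡ-≤ (σ a′ * (ρ u * ⟦ miss? a′ u ⟧)) (⟦⟧-mono (tri? v a a′) (tri? v a′ a) tri-swap₂) ⟩
        ⟦ tri? v a′ a ⟧ * (σ a′ * (ρ u * ⟦ miss? a′ u ⟧)) ∎
      codeg≤2 : ∀ {a} → S v a → codeg v a ≤ 2
      codeg≤2 (inj₁ fa) = m≤n⇒m≤1+n (F-codeg fa)
      codeg≤2 (inj₂ ca) = C-codeg ca
      bounded : ∀ a′ → codeg v a′ * sum (λ u → σ a′ * (ρ u * ⟦ miss? a′ u ⟧)) ≤ 2 * sum (λ u → σ a′ * (ρ u * ⟦ miss? a′ u ⟧))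
      bounded a′ = begin
        codeg v a′ * sum (λ u → σ a′ * (ρ u * ⟦ miss? a′ u ⟧))
          ≡⟨ cong (codeg v a′ *_) (*-distribˡ-sum (σ a′) (λ u → ρ u * ⟦ miss? a′ u ⟧)) ⟨
        codeg v a′ * (σ a′ * E)
          ≡⟨ x∙yz≈y∙xz (codeg v a′) (σ a′) E ⟩
        σ a′ * (codeg v a′ * E)
          ≤⟨ σ*-mono a′ (λ s → *-monoˡ-≤ E (codeg≤2 s)) ⟩
        σ a′ * (2 * E)
          ≡⟨ x∙yz≈y∙xz (σ a′) 2 E ⟩
        2 * (σ a′ * E)
          ≡⟨ cong (2 *_) (*-distribˡ-sum (σ a′) (λ u → ρ u * ⟦ miss? a′ u ⟧)) ⟩
        2 * sum (λ u → σ a′ * (ρ u * ⟦ miss? a′ u ⟧)) ∎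
        where
        E : ℕ
        E = sum (λ u → ρ u * ⟦ miss? a′ u ⟧)

    -- Vertices outside `S v` are bounded by the maximality of `W v`, those inside by their missing
    -- pairs.
    total-weight : (∀ a → W a ≤ W v) → sum W ≤ r * W v + (12 * X + 30 * c)
    total-weight maximal = begin
      sum W
        ≡⟨ sum-cong-≗ (λ a → trans (sym (*-identityˡ (W a))) (cong (_* W a) (trans (sym (σ+ρ≡1 a)) (+-comm (σ a) (ρ a))))) ⟩
      sum (λ a → (ρ a + σ a) * W a)
        ≤⟨ sum-mono pointwise ⟩
      sum (λ a → ρ a * W v + (6 * (σ a * farPairs a) + 30 * γ a))
        ≡⟨ trans (∑-distrib-+ (λ a → ρ a * W v) _) (cong₂ _+_ (sym (*-distribʳ-sum (W v) ρ))
             (trans (∑-distrib-+ (λ a → 6 * (σ a * farPairs a)) _)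
                    (sym (cong₂ _+_ (*-distribˡ-sum 6 (λ a → σ a * farPairs a)) (*-distribˡ-sum 30 γ))))) ⟩
      r * W v + (6 * sum (λ a → σ a * farPairs a) + 30 * c)
        ≤⟨ +-monoʳ-≤ (r * W v) (+-monoˡ-≤ (30 * c) (*-monoʳ-≤ 6 farPairs-total)) ⟩
      r * W v + (6 * (2 * X) + 30 * c)
        ≡⟨ cong (λ s → r * W v + (s + 30 * c)) (sym (*-assoc 6 2 X)) ⟩
      r * W v + (12 * X + 30 * c) ∎
      where
      open ≤-Reasoning
      regroup : ∀ p g k → p * (6 * k) + g * (6 * k + 30) ≡ 6 * ((p + g) * k) + 30 * g
      regroup = solve-∀
      inside : ∀ a → σ a * W a ≤ 6 * (σ a * farPairs a) + 30 * γ a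
      inside a = begin
        σ a * W a
          ≡⟨ *-distribʳ-+ (W a) (φ a) (γ a) ⟩
        φ a * W a + γ a * W a
          ≤⟨ +-mono-≤ (⟦⟧*-mono (F? v a) (F-W a)) (⟦⟧*-mono (C? v a) (C-W a)) ⟩
        φ a * (6 * farPairs a) + γ a * (6 * farPairs a + 30)
          ≡⟨ regroup (φ a) (γ a) (farPairs a) ⟩
        6 * (σ a * farPairs a) + 30 * γ a ∎
      pointwise : ∀ a → (ρ a + σ a) * W a ≤ ρ a * W v + (6 * (σ a * farPairs a) + 30 * γ a)
      pointwise a = begin
        (ρ a + σ a) * W a         ≡⟨ *-distribʳ-+ (W a) (ρ a) (σ a) ⟩
        ρ a * W a + σ a * W a     ≤⟨ +-mono-≤ (*-monoʳ-≤ (ρ a) (maximal a)) (inside a) ⟩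
        ρ a * W v + (6 * (σ a * farPairs a) + 30 * γ a) ∎

-- Counting faces by size

ι : Bool → ℕ
ι b = if b then 1 else 0

ι≤1 : ∀ b → ι b ≤ 1
ι≤1 true  = ≤-refl
ι≤1 false = z≤n

-- The sum of `g` over the `k`-element subsets, by Pascal's recursion on the first vertex.
levelSum : ∀ {n} → ℕ → (Subset n → ℕ) → ℕ
levelSum {zero}  zero    g = g []
levelSum {zero}  (suc k) g = 0
levelSum {suc n} zero    g = levelSum zero (g ∘ (false ∷_))
levelSum {suc n} (suc k) g = levelSum k (g ∘ (true ∷_)) + levelSum (suc k) (g ∘ (false ∷_))

levelsBelow : ∀ {n} → ℕ → (Subset n → ℕ) → ℕ
levelsBelow zero    g = 0
levelsBelow (suc k) g = levelsBelow k g + levelSum k g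

levelSum-zero : ∀ n k → levelSum {n} k (λ _ → 0) ≡ 0
levelSum-zero zero    zero    = refl
levelSum-zero zero    (suc k) = refl
levelSum-zero (suc n) zero    = levelSum-zero n zero
levelSum-zero (suc n) (suc k) = cong₂ _+_ (levelSum-zero n k) (levelSum-zero n (suc k))

levelSum-cong : ∀ {n} k {g h : Subset n → ℕ} → (∀ s → g s ≡ h s) → levelSum k g ≡ levelSum k h
levelSum-cong {zero}  zero    e = e []
levelSum-cong {zero}  (suc k) e = refl
levelSum-cong {suc n} zero    e = levelSum-cong zero (e ∘ (false ∷_))
levelSum-cong {suc n} (suc k) e = cong₂ _+_ (levelSum-cong k (e ∘ (true ∷_))) (levelSum-cong (suc k) (e ∘ (false ∷_)))

levelSum-∅ : ∀ {n} (g : Subset n → ℕ) → levelSum 0 g ≡ g ∅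
levelSum-∅ {zero}  g = refl
levelSum-∅ {suc n} g = levelSum-∅ (g ∘ (false ∷_))

-- Double counting: summing ∂ x g over all x and all k-sets counts every (k+1)-set k+1 times.
∂ : ∀ {n} → Fin n → (Subset n → ℕ) → Subset n → ℕ
∂ x g s = ι (not (lookup s x)) * g (s [ x ]≔ true)

levelSum-suc : ∀ {n} k (g : Subset n → ℕ) → suc k * levelSum (suc k) g ≡ sum (λ x → levelSum k (∂ x g))
levelSum-suc {zero}  k g = *-zeroʳ k
levelSum-suc {suc n} zero g = begin
  1 * (levelSum 0 g₁ + levelSum 1 g₀)
    ≡⟨ *-distribˡ-+ 1 (levelSum 0 g₁) _ ⟩
  1 * levelSum 0 g₁ + 1 * levelSum 1 g₀
    ≡⟨ cong₂ _+_ (trans (*-identityˡ _) (levelSum-cong 0 (λ s → sym (*-identityˡ (g₁ s))))) (levelSum-suc 0 g₀) ⟩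
  levelSum 0 (∂ zero g) + sum (λ x → levelSum 0 (∂ x g₀)) ∎
  where
  open ≡-Reasoning
  g₀ g₁ : Subset n → ℕ
  g₀ = g ∘ (false ∷_)
  g₁ = g ∘ (true ∷_)
levelSum-suc {suc n} (suc k) g = begin
  (2 + k) * (levelSum (suc k) g₁ + levelSum (2 + k) g₀)
    ≡⟨ *-distribˡ-+ (2 + k) (levelSum (suc k) g₁) _ ⟩
  (levelSum (suc k) g₁ + suc k * levelSum (suc k) g₁) + (2 + k) * levelSum (2 + k) g₀
    ≡⟨ +-assoc (levelSum (suc k) g₁) _ _ ⟩
  levelSum (suc k) g₁ + (suc k * levelSum (suc k) g₁ + (2 + k) * levelSum (2 + k) g₀)
    ≡⟨ cong₂ _+_ head-term (cong₂ _+_ (levelSum-suc k g₁) (levelSum-suc (suc k) g₀)) ⟩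
  levelSum (suc k) (∂ zero g) + (sum (λ x → levelSum k (∂ x g₁)) + sum (λ x → levelSum (suc k) (∂ x g₀)))
    ≡⟨ cong (levelSum (suc k) (∂ zero g) +_) (∑-distrib-+ (λ x → levelSum k (∂ x g₁)) _) ⟨
  levelSum (suc k) (∂ zero g) + sum (λ x → levelSum (suc k) (∂ (suc x) g)) ∎
  where
  open ≡-Reasoning
  g₀ g₁ : Subset n → ℕ
  g₀ = g ∘ (false ∷_)
  g₁ = g ∘ (true ∷_)
  -- `∂ zero g` vanishes on sets containing the first vertex, so only the other half survives.
  head-term : levelSum (suc k) g₁ ≡ levelSum (suc k) (∂ zero g)
  head-term = sym (cong₂ _+_ (levelSum-zero n k) (levelSum-cong (suc k) (λ s → *-identityˡ (g₁ s))))

levelsBelow-suc : ∀ {n} k (g : Subset (suc n) → ℕ) →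
  levelsBelow (suc k) g ≡ levelsBelow k (g ∘ (true ∷_)) + levelsBelow (suc k) (g ∘ (false ∷_))
levelsBelow-suc zero    g = refl
levelsBelow-suc (suc k) g = trans (cong (_+ levelSum (suc k) g) (levelsBelow-suc k g))
  (interchange (levelsBelow k (g ∘ (true ∷_))) _ _ _)

subsetSum : ∀ {n} → (Subset n → ℕ) → ℕ
subsetSum {n} g = ListAction.sum (map g (allSubsets n))

subsetSum-suc : ∀ {n} (g : Subset (suc n) → ℕ) → subsetSum g ≡ subsetSum (g ∘ (true ∷_)) + subsetSum (g ∘ (false ∷_))
subsetSum-suc {n} g = begin
  ListAction.sum (map g (allSubsets (suc n)))
    ≡⟨ cong ListAction.sum (map-++ g (map (true ∷_) (allSubsets n)) _) ⟩
  _ ≡⟨ sum-++ (map g (map (true ∷_) (allSubsets n))) _ ⟩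
  _ ≡⟨ cong₂ (λ a b → ListAction.sum a + ListAction.sum b) (map-∘ (allSubsets n)) (map-∘ (allSubsets n)) ⟨
  subsetSum (g ∘ (true ∷_)) + subsetSum (g ∘ (false ∷_)) ∎
  where open ≡-Reasoning

-- Applied with `k` = 5, this reduces `numEdges` to the faces with at most four vertices.
subsetSum-levels : ∀ {n} k (g : Subset n → ℕ) → (∀ s → k ≤ ∣ s ∣ → g s ≡ 0) → subsetSum g ≡ levelsBelow k g
subsetSum-levels {zero} zero    g h = cong (_+ 0) (h [] z≤n)
subsetSum-levels {zero} (suc k) g h = single k
  where
  single : ∀ k → g [] + 0 ≡ levelsBelow (suc k) g
  single zero    = +-identityʳ (g [])
  single (suc k) = trans (single k) (sym (+-identityʳ _))
subsetSum-levels {suc n} zero g h = trans (subsetSum-suc g)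
  (cong₂ _+_ (subsetSum-levels 0 (g ∘ (true ∷_)) (λ s _ → h (true ∷ s) z≤n))
             (subsetSum-levels 0 (g ∘ (false ∷_)) (λ s _ → h (false ∷ s) z≤n)))
subsetSum-levels {suc n} (suc k) g h = trans (subsetSum-suc g) (trans
  (cong₂ _+_ (subsetSum-levels k (g ∘ (true ∷_)) (λ s k≤s → h (true ∷ s) (s≤s k≤s)))
             (subsetSum-levels (suc k) (g ∘ (false ∷_)) (λ s k≤s → h (false ∷ s) k≤s)))
  (sym (levelsBelow-suc k g)))

-- Subsets as images and as lists

elements : ∀ {n} (s : Subset n) k → k ≤ ∣ s ∣ → ∃ λ (φ : Fin k → Fin n) → Injective _≡_ _≡_ φ × (∀ i → φ i ∈ s)
elements s zero _ = (λ ()) , (λ { {()} }) , λ ()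
elements (true ∷ s) (suc k) (s≤s k≤s) with elements s k k≤s
... | φ , inj , mem = φ⁺ , φ⁺-injective , φ⁺-∈
  where
  φ⁺ : Fin (suc k) → Fin _
  φ⁺ zero    = zero
  φ⁺ (suc i) = suc (φ i)
  φ⁺-injective : Injective _≡_ _≡_ φ⁺
  φ⁺-injective {zero}  {zero}  _ = refl
  φ⁺-injective {suc i} {suc j} e = cong suc (inj (suc-injective e))
  φ⁺-∈ : ∀ i → φ⁺ i ∈ true ∷ s
  φ⁺-∈ zero    = here
  φ⁺-∈ (suc i) = there (mem i)
elements (false ∷ s) (suc k) k≤s with elements s (suc k) k≤s
... | φ , inj , mem = suc ∘ φ , (λ { {i} {j} e → inj (suc-injective e) }) , there ∘ mem

anyFin-true : ∀ {m} (p : Fin m → Bool) → anyFin p ≡ true → ∃ λ i → p i ≡ true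
anyFin-true {suc m} p e with p zero in eq
... | true  = zero , eq
... | false with anyFin-true (p ∘ suc) e
...   | i , q = suc i , q

∈-image : ∀ {m n} (φ : Fin m → Fin n) (e : Subset m) {j} → j ∈ image φ e → ∃ λ i → i ∈ e × φ i ≡ j
∈-image φ e {j} j∈ with anyFin-true _ (trans (sym (lookup∘tabulate _ j)) ([]=⇒lookup j∈))
... | i , p with lookup e i in eq | φ i ≟ j
...   | true | yes q = i , lookup⇒[]= i e eq , q

fromList : ∀ {n} → List (Fin n) → Subset n
fromList []       = ∅
fromList (x ∷ xs) = fromList xs [ x ]≔ true

∈-fromList⁺ : ∀ {n} {x : Fin n} {xs} → x List.∈ xs → x ∈ fromList xs
∈-fromList⁺ {xs = y ∷ xs} (here refl) = lookup⇒[]= y _ (lookup∘update y (fromList xs) true)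
∈-fromList⁺ {x = x} {xs = y ∷ xs} (there x∈) with x ≟ y
... | yes refl = lookup⇒[]= y _ (lookup∘update y (fromList xs) true)
... | no x≢y   = lookup⇒[]= x _ (trans (lookup∘update′ x≢y (fromList xs) true) ([]=⇒lookup (∈-fromList⁺ x∈)))

∈-fromList⁻ : ∀ {n} {x : Fin n} xs → x ∈ fromList xs → x List.∈ xs
∈-fromList⁻ {x = x} [] x∈ with trans (sym (lookup-replicate x false)) ([]=⇒lookup x∈)
... | ()
∈-fromList⁻ {x = x} (y ∷ xs) x∈ with x ≟ y
... | yes refl = here refl
... | no x≢y   = there (∈-fromList⁻ xs (lookup⇒[]= x _ (trans (sym (lookup∘update′ x≢y (fromList xs) true)) ([]=⇒lookup x∈))))

-- If `x` already occurs in `xs`, the factor in `∂` is 0. Iterated from `∅`, this restricts the sums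
-- to lists without repetition.
∂-≤ : ∀ {n} (x : Fin n) xs (g : Subset n → ℕ) {k} → (All (x ≢_) xs → g (fromList (x ∷ xs)) ≤ k) → ∂ x g (fromList xs) ≤ k
∂-≤ x xs g h with lookup (fromList xs) x in eq
... | true  = z≤n
... | false = ≤-trans (≤-reflexive (*-identityˡ _)) (h (All.tabulate λ y∈ x≡y → absurd (subst (List._∈ xs) (sym x≡y) y∈)))
  where
  absurd : ¬ x List.∈ xs
  absurd x∈ with trans (sym eq) ([]=⇒lookup (∈-fromList⁺ x∈))
  ... | ()

-- Faces as ordered tuples

module _ {n : ℕ} (H : SimplicialComplex n) where

  -- Requiring distinct entries makes tuples of vertices count a face of size `k` exactly `k`!
  -- times; hence the factors 2, 6 and 24 below.
  Face : List (Fin n) → Set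
  Face xs = Unique xs × edge H (fromList xs) ≡ true

  face? : ∀ xs → Dec (Face xs)
  face? xs = UniqueDec.unique? _≟_ xs ×-dec (edge H (fromList xs) ≟ᵇ true)

  face-⊆ : ∀ {xs ys} → Face xs → Unique ys → (∀ {x} → x List.∈ ys → x List.∈ xs) → Face ys
  face-⊆ {xs} {ys} (_ , e) u sub =
    u , downward H (fromList ys) (fromList xs) (λ x∈ → ∈-fromList⁺ (sub (∈-fromList⁻ ys x∈))) e

  edgeInd : Subset n → ℕ
  edgeInd s = ι (edge H s)

  edgeInd-≤ : ∀ xs → Unique xs → edgeInd (fromList xs) ≤ ⟦ face? xs ⟧
  edgeInd-≤ xs u = cases (edge H (fromList xs)) refl
    where
    cases : ∀ b → edge H (fromList xs) ≡ b → ι b ≤ ⟦ face? xs ⟧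
    cases false _ = z≤n
    cases true  e = ⟦⟧-pos (face? xs) (u , e)

  count₁ : levelSum 1 edgeInd ≤ n
  count₁ = begin
    levelSum 1 edgeInd                       ≡⟨ *-identityˡ _ ⟨
    1 * levelSum 1 edgeInd                   ≡⟨ levelSum-suc 0 edgeInd ⟩
    sum (λ x → levelSum 0 (∂ x edgeInd))     ≡⟨ sum-cong-≗ (λ x → levelSum-∅ (∂ x edgeInd)) ⟩
    sum (λ x → ∂ x edgeInd ∅)                ≤⟨ sum-mono (λ x → ∂-≤ x [] edgeInd (λ _ → ι≤1 _)) ⟩
    sum {n} (λ _ → 1)                        ≡⟨ sum-const n 1 ⟩
    n * 1                                    ≡⟨ *-identityʳ n ⟩
    n                                        ∎
    where open ≤-Reasoning

  levelSum-suc₂ : ∀ k g → (2 + k) * (suc k * levelSum (2 + k) g) ≡ sum₂ (λ x y → levelSum {n} k (∂ y (∂ x g)))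
  levelSum-suc₂ k g = begin
    (2 + k) * (suc k * levelSum (2 + k) g)              ≡⟨ x∙yz≈y∙xz (2 + k) (suc k) (levelSum (2 + k) g) ⟩
    suc k * ((2 + k) * levelSum (2 + k) g)              ≡⟨ cong (suc k *_) (levelSum-suc (suc k) g) ⟩
    suc k * sum (λ x → levelSum (suc k) (∂ x g))        ≡⟨ *-distribˡ-sum (suc k) (λ x → levelSum (suc k) (∂ x g)) ⟩
    sum (λ x → suc k * levelSum (suc k) (∂ x g))        ≡⟨ sum-cong-≗ (λ x → levelSum-suc k (∂ x g)) ⟩
    sum₂ (λ x y → levelSum k (∂ y (∂ x g)))             ∎
    where
    open ≡-Reasoning

  count₂ : 2 * levelSum 2 edgeInd ≤ sum₂ (λ x y → ⟦ face? (x ∷ y ∷ []) ⟧)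
  count₂ = begin
    2 * levelSum 2 edgeInd                               ≡⟨ cong (2 *_) (*-identityˡ (levelSum 2 edgeInd)) ⟨
    2 * (1 * levelSum 2 edgeInd)                         ≡⟨ levelSum-suc₂ 0 edgeInd ⟩
    sum₂ (λ x y → levelSum 0 (∂ y (∂ x edgeInd)))        ≡⟨ sum₂-cong (λ x y → levelSum-∅ (∂ y (∂ x edgeInd))) ⟩
    sum₂ (λ x y → ∂ y (∂ x edgeInd) ∅)                   ≤⟨ sum₂-mono (λ x y → ∂-≤ y [] (∂ x edgeInd) λ a₁ → ∂-≤ x (y ∷ []) edgeInd λ a₂ → edgeInd-≤ (x ∷ y ∷ []) (a₂ ∷ a₁ ∷ [])) ⟩
    sum₂ (λ x y → ⟦ face? (x ∷ y ∷ []) ⟧)                ∎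
    where open ≤-Reasoning

  count₃ : 6 * levelSum 3 edgeInd ≤ sum₃ (λ x y z → ⟦ face? (x ∷ y ∷ z ∷ []) ⟧)
  count₃ = begin
    6 * levelSum 3 edgeInd
      ≡⟨ *-assoc 3 2 (levelSum 3 edgeInd) ⟩
    3 * (2 * levelSum 3 edgeInd)
      ≡⟨ levelSum-suc₂ 1 edgeInd ⟩
    sum₂ (λ x y → levelSum 1 (∂ y (∂ x edgeInd)))
      ≡⟨ sum₂-cong (λ x y → trans (sym (*-identityˡ _)) (trans (levelSum-suc 0 (∂ y (∂ x edgeInd)))
           (sum-cong-≗ λ z → levelSum-∅ (∂ z (∂ y (∂ x edgeInd)))))) ⟩
    sum₃ (λ x y z → ∂ z (∂ y (∂ x edgeInd)) ∅)
      ≤⟨ sum₃-mono (λ x y z → ∂-≤ z [] (∂ y (∂ x edgeInd)) λ a₁ → ∂-≤ y (z ∷ []) (∂ x edgeInd) λ a₂ →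
           ∂-≤ x (y ∷ z ∷ []) edgeInd λ a₃ → edgeInd-≤ (x ∷ y ∷ z ∷ []) (a₃ ∷ a₂ ∷ a₁ ∷ [])) ⟩
    sum₃ (λ x y z → ⟦ face? (x ∷ y ∷ z ∷ []) ⟧) ∎
    where open ≤-Reasoning

  count₄ : 24 * levelSum 4 edgeInd ≤ sum₂ (λ x y → sum₂ λ z w → ⟦ face? (x ∷ y ∷ z ∷ w ∷ []) ⟧)
  count₄ = begin
    24 * levelSum 4 edgeInd
      ≡⟨ factor (levelSum 4 edgeInd) ⟩
    2 * (4 * (3 * levelSum 4 edgeInd))
      ≡⟨ cong (2 *_) (levelSum-suc₂ 2 edgeInd) ⟩
    2 * sum₂ (λ x y → levelSum 2 (∂ y (∂ x edgeInd)))
      ≡⟨ sum₂-* 2 (λ x y → levelSum 2 (∂ y (∂ x edgeInd))) ⟨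
    sum₂ (λ x y → 2 * levelSum 2 (∂ y (∂ x edgeInd)))
      ≡⟨ sum₂-cong (λ x y → trans (cong (2 *_) (sym (*-identityˡ (levelSum 2 (∂ y (∂ x edgeInd)))))) (trans (levelSum-suc₂ 0 (∂ y (∂ x edgeInd)))
           (sum₂-cong λ z w → levelSum-∅ (∂ w (∂ z (∂ y (∂ x edgeInd))))))) ⟩
    sum₂ (λ x y → sum₂ λ z w → ∂ w (∂ z (∂ y (∂ x edgeInd))) ∅)
      ≤⟨ sum₂-mono (λ x y → sum₂-mono λ z w → ∂-≤ w [] (∂ z (∂ y (∂ x edgeInd))) λ a₁ →
           ∂-≤ z (w ∷ []) (∂ y (∂ x edgeInd)) λ a₂ → ∂-≤ y (z ∷ w ∷ []) (∂ x edgeInd) λ a₃ →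
           ∂-≤ x (y ∷ z ∷ w ∷ []) edgeInd λ a₄ → edgeInd-≤ (x ∷ y ∷ z ∷ w ∷ []) (a₄ ∷ a₃ ∷ a₂ ∷ a₁ ∷ [])) ⟩
    sum₂ (λ x y → sum₂ λ z w → ⟦ face? (x ∷ y ∷ z ∷ w ∷ []) ⟧) ∎
    where
    open ≤-Reasoning
    factor : ∀ a → 24 * a ≡ 2 * (4 * (3 * a))
    factor = solve-∀

  -- The link system of a B-free complex

  module _ (free : ¬ ContainsCopy BEdge H) where

    -- Any injection of five vertices into a single edge is a copy of `B`, by downward closure.
    large-not-edge : ∀ s → 5 ≤ ∣ s ∣ → edgeInd s ≡ 0
    large-not-edge s 5≤s with edge H s in eq
    ... | false = refl
    ... | true with elements s 5 5≤s
    ...   | φ , inj , mem = ⊥-elim (free (φ , inj , λ e _ → downward H (image φ e) s (sub e) eq))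
      where
      sub : ∀ e → image φ e ⊆ s
      sub e j∈ with ∈-image φ e j∈
      ... | i , _ , refl = mem i

    B-free : ∀ {v x y z w} → Face (v ∷ x ∷ y ∷ []) → Face (v ∷ z ∷ w ∷ []) →
             x ≢ z → x ≢ w → y ≢ z → y ≢ w → ¬ Face (y ∷ z ∷ [])
    B-free {v} {x} {y} {z} {w} (((v≢x ∷ v≢y ∷ []) ∷ (x≢y ∷ []) ∷ [] ∷ []) , vxy) (((v≢z ∷ v≢w ∷ []) ∷ (z≢w ∷ []) ∷ [] ∷ []) , vzw)
      x≢z x≢w y≢z y≢w (_ , yz) = free (φ , injective , copy)
      where
      points : Vec (Fin n) 5
      -- The five vertices of `B` in order, so that its lone pair becomes the face `y z`.
      points = v ∷ x ∷ y ∷ z ∷ w ∷ []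
      φ : Fin 5 → Fin n
      φ = lookup points
      distinct : VecPairs.AllPairs _≢_ points
      distinct = (v≢x VecAll.∷ v≢y VecAll.∷ v≢z VecAll.∷ v≢w VecAll.∷ VecAll.[])
        VecPairs.∷ (x≢y VecAll.∷ x≢z VecAll.∷ x≢w VecAll.∷ VecAll.[])
        VecPairs.∷ (y≢z VecAll.∷ y≢w VecAll.∷ VecAll.[])
        VecPairs.∷ (z≢w VecAll.∷ VecAll.[]) VecPairs.∷ VecAll.[] VecPairs.∷ VecPairs.[]
      injective : Injective _≡_ _≡_ φ
      injective {i} {j} = lookup-injective distinct i j
      image-edge : ∀ (b : Subset 5) xs → (∀ i → i ∈ b → φ i List.∈ xs) → edge H (fromList xs) ≡ true →
                   ∀ e → e ⊆ b → edge H (image φ e) ≡ true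
      image-edge b xs inc E e e⊆b = downward H (image φ e) (fromList xs) sub E
        where
        sub : image φ e ⊆ fromList xs
        sub j∈ with ∈-image φ e j∈
        ... | i , i∈e , refl = ∈-fromList⁺ (inc i (e⊆b i∈e))
      inc34 : ∀ i → i ∈ b34 → φ i List.∈ (y ∷ z ∷ [])
      inc34 1F (there ())
      inc34 2F _ = here refl
      inc34 3F _ = there (here refl)
      inc34 4F (there (there (there (there ()))))
      inc123 : ∀ i → i ∈ b123 → φ i List.∈ (v ∷ x ∷ y ∷ [])
      inc123 0F _ = here refl
      inc123 1F _ = there (here refl)
      inc123 2F _ = there (there (here refl))
      inc123 3F (there (there (there ())))
      inc123 4F (there (there (there (there ()))))
      inc145 : ∀ i → i ∈ b145 → φ i List.∈ (v ∷ z ∷ w ∷ [])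
      inc145 0F _ = here refl
      inc145 1F (there ())
      inc145 2F (there (there ()))
      inc145 3F _ = there (here refl)
      inc145 4F _ = there (there (here refl))
      copy : ∀ e → BEdge e → edge H (image φ e) ≡ true
      copy e (inj₁ e⊆)        = image-edge b34 _ inc34 yz e e⊆
      copy e (inj₂ (inj₁ e⊆)) = image-edge b123 _ inc123 vxy e e⊆
      copy e (inj₂ (inj₂ e⊆)) = image-edge b145 _ inc145 vzw e e⊆

    linkSystem : LinkSystem n
    linkSystem = record
      { Adj  = λ x y → Face (x ∷ y ∷ [])
      ; Tri  = λ x y z → Face (x ∷ y ∷ z ∷ [])
      ; Quad = λ x y z w → Face (x ∷ y ∷ z ∷ w ∷ [])
      ; adj?  = λ x y → face? _
      ; tri?  = λ x y z → face? _
      ; quad? = λ x y z w → face? _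
      ; adj-irr = λ { (((p ∷ []) ∷ _) , _) → p }
      ; adj-sym = λ { F@(((p ∷ []) ∷ _) , _) → face-⊆ F ((≢-sym p ∷ []) ∷ [] ∷ [])
          λ { (here refl) → there (here refl) ; (there (here refl)) → here refl } }
      ; tri-adj = λ { F@(((p ∷ _) ∷ _) , _) → face-⊆ F ((p ∷ []) ∷ [] ∷ [])
          λ { (here refl) → here refl ; (there (here refl)) → there (here refl) } }
      ; tri-swap = λ { F@(((p ∷ q ∷ []) ∷ (r ∷ []) ∷ _) , _) → face-⊆ F ((≢-sym p ∷ r ∷ []) ∷ (q ∷ []) ∷ [] ∷ [])
          λ { (here refl) → there (here refl) ; (there (here refl)) → here refl ; (there (there i)) → there (there i) } }
      ; tri-rot = λ { F@(((p ∷ q ∷ []) ∷ (r ∷ []) ∷ _) , _) → face-⊆ F ((r ∷ ≢-sym p ∷ []) ∷ (≢-sym q ∷ []) ∷ [] ∷ [])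
          λ { (here refl) → there (here refl) ; (there (here refl)) → there (there (here refl)) ; (there (there (here refl))) → here refl } }
      ; quad-tri = λ { F@(((p ∷ q ∷ _) ∷ (r ∷ _) ∷ _) , _) → face-⊆ F ((p ∷ q ∷ []) ∷ (r ∷ []) ∷ [] ∷ [])
          λ { (here refl) → here refl ; (there (here refl)) → there (here refl) ; (there (there (here refl))) → there (there (here refl)) } }
      ; quad-rot = λ { F@(((p ∷ q ∷ s ∷ []) ∷ (r ∷ t ∷ []) ∷ (o ∷ []) ∷ _) , _) → face-⊆ F
          ((r ∷ t ∷ ≢-sym p ∷ []) ∷ (o ∷ ≢-sym q ∷ []) ∷ (≢-sym s ∷ []) ∷ [] ∷ [])
          λ { (here refl) → there (here refl) ; (there (here refl)) → there (there (here refl))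
            ; (there (there (here refl))) → there (there (there (here refl))) ; (there (there (there (here refl)))) → here refl } }
      ; no-B = B-free
      }

-- Assembling the estimate

2ab≤a²+b² : ∀ a b → 2 * (a * b) ≤ a * a + b * b
2ab≤a²+b² a b with ≤-total a b
... | inj₁ a≤b with m≤n⇒∃[o]m+o≡n a≤b
...   | d , refl = ≤-trans (m≤m+n _ (d * d)) (≤-reflexive (square a d))
  where
  square : ∀ a d → 2 * (a * (a + d)) + d * d ≡ a * a + (a + d) * (a + d)
  square = solve-∀
2ab≤a²+b² a b | inj₂ b≤a with m≤n⇒∃[o]m+o≡n b≤a
...   | d , refl = ≤-trans (m≤m+n _ (d * d)) (≤-reflexive (square b d))
  where
  square : ∀ b d → 2 * ((b + d) * b) + d * d ≡ (b + d) * (b + d) + b * b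
  square = solve-∀

-- The difference of the two sides is 3 (r + 2 − 3 s)² + 4 c (r − 60) + const;
-- when r < 60, either the square dominates the negative term or s is bounded.
quadratic-bound : ∀ r s c → c ≤ s →
  24 * (r * s) + (48 * s + 240 * c) ≤ 3 * ((s + r) * (s + r)) + 12 * (s + r) + 24 * (s * s) + 78000 + 4 * (r * c)
quadratic-bound r s c c≤s with 60 ≤? r
... | yes 60≤r = begin
  24 * (r * s) + (48 * s + 240 * c)
    -- Since `r` is at least 60, `4 * (r * c)` absorbs `240 * c`.
    ≤⟨ +-monoʳ-≤ (24 * (r * s)) (+-monoʳ-≤ (48 * s) (≤-trans (≤-reflexive (*-assoc 4 60 c)) (*-monoʳ-≤ 4 (*-monoˡ-≤ c 60≤r)))) ⟩
  24 * (r * s) + (48 * s + 4 * (r * c))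
    ≡⟨ regroup₁ r s (r * c) ⟩
  3 * (2 * ((r + 2) * (3 * s))) + (6 * (r * s) + 12 * s + 4 * (r * c))
    ≤⟨ +-monoˡ-≤ _ (*-monoʳ-≤ 3 (2ab≤a²+b² (r + 2) (3 * s))) ⟩
  3 * ((r + 2) * (r + 2) + 3 * s * (3 * s)) + (6 * (r * s) + 12 * s + 4 * (r * c))
    ≡⟨ regroup₂ r s (r * c) ⟩
  3 * ((s + r) * (s + r)) + 12 * (s + r) + 24 * (s * s) + 12 + 4 * (r * c)
    ≤⟨ +-monoˡ-≤ (4 * (r * c)) (+-monoʳ-≤ (3 * ((s + r) * (s + r)) + 12 * (s + r) + 24 * (s * s)) (m≤m+n 12 77988)) ⟩
  3 * ((s + r) * (s + r)) + 12 * (s + r) + 24 * (s * s) + 78000 + 4 * (r * c) ∎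
  where
  open ≤-Reasoning
  regroup₁ : ∀ r s x → 24 * (r * s) + (48 * s + 4 * x) ≡ 3 * (2 * ((r + 2) * (3 * s))) + (6 * (r * s) + 12 * s + 4 * x)
  regroup₁ = solve-∀
  regroup₂ : ∀ r s x → 3 * ((r + 2) * (r + 2) + 3 * s * (3 * s)) + (6 * (r * s) + 12 * s + 4 * x)
    ≡ 3 * ((s + r) * (s + r)) + 12 * (s + r) + 24 * (s * s) + 12 + 4 * x
  regroup₂ = solve-∀
... | no 60≰r = begin
  24 * (r * s) + (48 * s + 240 * c)
    ≡⟨ regroup₁ (r * s) s c ⟩
  18 * (r * s) + (6 * (r * s) + (48 * s + 240 * c))
    ≤⟨ +-mono-≤ (*-monoʳ-≤ 18 (*-monoˡ-≤ s (<⇒≤ (≰⇒> 60≰r)))) (+-monoʳ-≤ (6 * (r * s)) (+-monoʳ-≤ (48 * s) (*-monoʳ-≤ 240 c≤s))) ⟩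
  18 * (60 * s) + (6 * (r * s) + (48 * s + 240 * s))
    ≡⟨ regroup₂ (r * s) s ⟩
  6 * (r * s) + 1368 * s
    ≤⟨ +-monoʳ-≤ (6 * (r * s)) (linear (57 ≤? s)) ⟩
  6 * (r * s) + (24 * (s * s) + 78000)
    ≤⟨ m≤m+n _ (3 * (s * s) + 3 * (r * r) + 12 * (s + r) + 4 * (r * c)) ⟩
  6 * (r * s) + (24 * (s * s) + 78000) + (3 * (s * s) + 3 * (r * r) + 12 * (s + r) + 4 * (r * c))
    ≡⟨ regroup₃ r s (r * c) 78000 ⟩
  3 * ((s + r) * (s + r)) + 12 * (s + r) + 24 * (s * s) + 78000 + 4 * (r * c) ∎
  where
  open ≤-Reasoning
  regroup₁ : ∀ x s c → 24 * x + (48 * s + 240 * c) ≡ 18 * x + (6 * x + (48 * s + 240 * c))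
  regroup₁ = solve-∀
  regroup₂ : ∀ x s → 18 * (60 * s) + (6 * x + (48 * s + 240 * s)) ≡ 6 * x + 1368 * s
  regroup₂ = solve-∀
  regroup₃ : ∀ r s x k → 6 * (r * s) + (24 * (s * s) + k) + (3 * (s * s) + 3 * (r * r) + 12 * (s + r) + 4 * x)
    ≡ 3 * ((s + r) * (s + r)) + 12 * (s + r) + 24 * (s * s) + k + 4 * x
  regroup₃ = solve-∀
  -- 1368 = 24 * 57, and 1368 * 57 = 77976 is rounded up to 78000.
  linear : Dec (57 ≤ s) → 1368 * s ≤ 24 * (s * s) + 78000
  linear (yes 57≤s) = ≤-trans (≤-reflexive (*-assoc 24 57 s)) (m≤n⇒m≤n+o 78000 (*-monoʳ-≤ 24 (*-monoˡ-≤ s 57≤s)))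
  linear (no 57≰s)  = m≤n⇒m≤o+n (24 * (s * s)) (≤-trans (*-monoʳ-≤ 1368 (<⇒≤ (≰⇒> 57≰s))) (m≤m+n 77976 24))

-- Vertices of `C v` weigh 5 rather than 6, so four times the weight leaves a slack `4 * (r * c)` to
-- be spent in `quadratic-bound`. The `48 * X` from the weight and `24 * Y` from the square combine
-- to `24 * (Y + 2 * X)`.
combine : ∀ {r f c X Y M w} →
  w ≤ r * (6 * f + 5 * c) + (12 * X + 30 * c) →
  Y + 2 * X ≤ M →
  (f + c) * (f + c) ≤ Y + ((f + c) + (f + 6 * c)) →
  4 * w ≤ 3 * (((f + c) + r) * ((f + c) + r)) + 12 * ((f + c) + r) + 24 * M + 78000
combine {r} {f} {c} {X} {Y} {M} {w} weight≤ miss≤ square≤ = +-cancelʳ-≤ (24 * (s * s) + 4 * (r * c)) _ _ (begin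
  4 * w + (24 * (s * s) + 4 * (r * c))
    ≤⟨ +-mono-≤ (*-monoʳ-≤ 4 weight≤) (+-monoˡ-≤ (4 * (r * c)) (*-monoʳ-≤ 24 square≤)) ⟩
  4 * (r * (6 * f + 5 * c) + (12 * X + 30 * c)) + (24 * (Y + (s + (f + 6 * c))) + 4 * (r * c))
    ≡⟨ regroup₁ r f c X Y ⟩
  24 * (Y + 2 * X) + (24 * (r * s) + (48 * s + 240 * c))
    ≤⟨ +-mono-≤ (*-monoʳ-≤ 24 miss≤) (quadratic-bound r s c (m≤n+m c f)) ⟩
  24 * M + (3 * ((s + r) * (s + r)) + 12 * (s + r) + 24 * (s * s) + 78000 + 4 * (r * c))
    ≡⟨ regroup₂ (24 * M) (3 * ((s + r) * (s + r))) (12 * (s + r)) (24 * (s * s)) 78000 (4 * (r * c)) ⟩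
  3 * ((s + r) * (s + r)) + 12 * (s + r) + 24 * M + 78000 + (24 * (s * s) + 4 * (r * c)) ∎)
  where
  open ≤-Reasoning
  s : ℕ
  s = f + c
  regroup₁ : ∀ r f c X Y →
    4 * (r * (6 * f + 5 * c) + (12 * X + 30 * c)) + (24 * (Y + ((f + c) + (f + 6 * c))) + 4 * (r * c))
    ≡ 24 * (Y + 2 * X) + (24 * (r * (f + c)) + (48 * (f + c) + 240 * c))
  regroup₁ = solve-∀
  regroup₂ : ∀ m a b d k e → m + (a + b + d + k + e) ≡ a + b + m + k + (d + e)
  regroup₂ = solve-∀

module _ {n : ℕ} (L : LinkSystem n) where
  open LinkSystem L
  open Links L

  total-weight-≤ : ∀ v → (∀ a → W a ≤ W v) → 4 * sum W ≤ 3 * (n * n) + 12 * n + 24 * sum₂ (λ x y → ⟦ miss? x y ⟧) + 78000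
  total-weight-≤ v maximal = subst (λ k → 4 * sum W ≤ 3 * (k * k) + 12 * k + 24 * M + 78000) partition
    (combine {r} {f} {c} {X} {Y} {M} {sum W} (subst (λ k → sum W ≤ r * k + (12 * X + 30 * c)) W-v (total-weight maximal)) miss-count square-bound)
    where open Neighbourhood v

  pair-count : sum₂ (λ x y → ⟦ adj? x y ⟧) + sum₂ (λ x y → ⟦ miss? x y ⟧) + n ≤ n * n
  pair-count = begin
    A + M + n
      ≡⟨ cong (A + M +_) diagonal ⟨
    A + M + sum₂ {n} (λ x y → ⟦ y ≟ x ⟧)
      ≡⟨ trans (sum₂-+ (λ x y → ⟦ adj? x y ⟧ + ⟦ miss? x y ⟧) _) (cong (_+ sum₂ {n} (λ x y → ⟦ y ≟ x ⟧)) (sum₂-+ (λ x y → ⟦ adj? x y ⟧) _)) ⟨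
    sum₂ (λ x y → ⟦ adj? x y ⟧ + ⟦ miss? x y ⟧ + ⟦ y ≟ x ⟧)
      ≤⟨ sum₂-mono (λ x y → exclusive x y (adj? x y) (miss? x y) (y ≟ x)) ⟩
    sum {n} (λ x → sum {n} (λ y → 1))
      ≡⟨ trans (sum-cong-≗ {n} (λ x → trans (sum-const n 1) (*-identityʳ n))) (sum-const n n) ⟩
    n * n ∎
    where
    open ≤-Reasoning
    A M : ℕ
    A = sum₂ (λ x y → ⟦ adj? x y ⟧)
    M = sum₂ (λ x y → ⟦ miss? x y ⟧)
    diagonal : sum₂ {n} (λ x y → ⟦ y ≟ x ⟧) ≡ n
    diagonal = trans (sum-cong-≗ {n} (λ x → sum-≟ x)) (trans (sum-const n 1) (*-identityʳ n))
    exclusive : ∀ x y (a : Dec (Adj x y)) (b : Dec (Miss x y)) (e : Dec (y ≡ x)) → ⟦ a ⟧ + ⟦ b ⟧ + ⟦ e ⟧ ≤ 1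
    exclusive x y (yes a) (yes (_ , ¬a)) e = contradiction a ¬a
    exclusive x y (yes a) (no _) (yes p) = contradiction (sym p) (adj-irr a)
    exclusive x y (yes a) (no _) (no _) = ≤-refl
    exclusive x y (no _) (yes (x≢y , _)) (yes p) = contradiction (sym p) x≢y
    exclusive x y (no _) (yes _) (no _) = ≤-refl
    exclusive x y (no _) (no _) e = ⟦⟧≤1 e

2*nC2+n≡n² : ∀ n → 2 * (n C 2) + n ≡ n * n
2*nC2+n≡n² zero    = refl
2*nC2+n≡n² (suc n) = begin
  2 * (suc n C 2) + suc n         ≡⟨ cong (λ k → 2 * k + suc n) (nCk+nC[k+1]≡[n+1]C[k+1] n 1) ⟨
  2 * (n C 1 + n C 2) + suc n     ≡⟨ cong (λ k → 2 * (k + n C 2) + suc n) (nC1≡n n) ⟩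
  2 * (n + n C 2) + suc n         ≡⟨ regroup n (n C 2) ⟩
  (2 * (n C 2) + n) + (2 * n + 1) ≡⟨ cong (_+ (2 * n + 1)) (2*nC2+n≡n² n) ⟩
  n * n + (2 * n + 1)             ≡⟨ square n ⟩
  suc n * suc n                   ∎
  where
  open ≡-Reasoning
  regroup : ∀ n k → 2 * (n + k) + suc n ≡ (2 * k + n) + (2 * n + 1)
  regroup = solve-∀
  square : ∀ n → n * n + (2 * n + 1) ≡ suc n * suc n
  square = solve-∀

-- Everything is scaled by 96 = 6 * 16. Adding `48 * n + 48 * M` completes the adjacent pairs to all
-- ordered pairs, so the pairs missing from `A` pay exactly for the term `24 * M` in the weight
-- bound.
final-count : ∀ {n L₀ L₁ L₂ L₃ L₄ A T Q M w B} →
  L₀ ≤ 1 → L₁ ≤ n → 2 * L₂ ≤ A → 6 * L₃ ≤ T → 24 * L₄ ≤ Q →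
  4 * T + Q ≤ 2 * w → 4 * w ≤ 3 * (n * n) + 12 * n + 24 * M + 78000 →
  A + M + n ≤ n * n → 2 * B + n ≡ n * n →
  16 * (0 + L₀ + L₁ + L₂ + L₃ + L₄) ≤ 18 * B + 21 * n + 16 * 1626
final-count {n} {L₀} {L₁} {L₂} {L₃} {L₄} {A} {T} {Q} {M} {w} {B} h₀ h₁ h₂ h₃ h₄ charge weight pairs binom =
  *-cancelˡ-≤ 6 (+-cancelʳ-≤ (48 * n + 48 * M) _ _ (begin
    6 * (16 * (0 + L₀ + L₁ + L₂ + L₃ + L₄)) + (48 * n + 48 * M)
      ≡⟨ regroup₁ L₀ L₁ L₂ L₃ L₄ n M ⟩
    96 * L₀ + 96 * L₁ + 48 * (2 * L₂) + (4 * (4 * (6 * L₃) + 24 * L₄)) + (48 * n + 48 * M)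
      ≤⟨ +-monoˡ-≤ (48 * n + 48 * M) (+-mono-≤ (+-mono-≤ (+-mono-≤ (*-monoʳ-≤ 96 h₀) (*-monoʳ-≤ 96 h₁)) (*-monoʳ-≤ 48 h₂))
           (*-monoʳ-≤ 4 (≤-trans (+-mono-≤ (*-monoʳ-≤ 4 h₃) h₄) charge))) ⟩
    96 + 96 * n + 48 * A + 4 * (2 * w) + (48 * n + 48 * M)
      ≡⟨ regroup₂ n A w M ⟩
    96 + 96 * n + 48 * (A + M + n) + 2 * (4 * w)
      ≤⟨ +-mono-≤ (+-monoʳ-≤ (96 + 96 * n) (*-monoʳ-≤ 48 pairs)) (*-monoʳ-≤ 2 weight) ⟩
    96 + 96 * n + 48 * (n * n) + 2 * (3 * (n * n) + 12 * n + 24 * M + 78000)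
      ≡⟨ regroup₃ n (n * n) M ⟩
    54 * (n * n) + 120 * n + 156096 + 48 * M
      ≡⟨ cong (λ k → 54 * k + 120 * n + 156096 + 48 * M) binom ⟨
    54 * (2 * B + n) + 120 * n + 156096 + 48 * M
      ≡⟨ regroup₄ B n M ⟩
    6 * (18 * B + 21 * n + 16 * 1626) + (48 * n + 48 * M) ∎))
  where
  open ≤-Reasoning
  regroup₁ : ∀ a b c d e n M → 6 * (16 * (0 + a + b + c + d + e)) + (48 * n + 48 * M)
    ≡ 96 * a + 96 * b + 48 * (2 * c) + (4 * (4 * (6 * d) + 24 * e)) + (48 * n + 48 * M)
  regroup₁ = solve-∀
  regroup₂ : ∀ n A w M → 96 + 96 * n + 48 * A + 4 * (2 * w) + (48 * n + 48 * M) ≡ 96 + 96 * n + 48 * (A + M + n) + 2 * (4 * w)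
  regroup₂ = solve-∀
  regroup₃ : ∀ n q M → 96 + 96 * n + 48 * q + 2 * (3 * q + 12 * n + 24 * M + 78000) ≡ 54 * q + 120 * n + 156096 + 48 * M
  regroup₃ = solve-∀
  regroup₄ : ∀ B n M → 54 * (2 * B + n) + 120 * n + 156096 + 48 * M ≡ 6 * (18 * B + 21 * n + 16 * 1626) + (48 * n + 48 * M)
  regroup₄ = solve-∀

maximum : ∀ {n} → 1 ≤ n → (h : Fin n → ℕ) → ∃ λ v → ∀ a → h a ≤ h v
maximum {suc m} _ h = argmax h zero (allFin (suc m)) ,
  λ a → All.lookup (f[xs]≤f[argmax] {f = h} zero (allFin (suc m))) (∈-allFin a)

theorem1p2 : Σ ℕ (λ K → ∀ (n : ℕ) → 5 ≤ n → ∀ (H : SimplicialComplex n) → ¬ ContainsCopy BEdge H → 16 * numEdges H ≤ 18 * (n C 2) + 21 * n + 16 * K)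
-- 1626 = (96 + 2 * 78000) / 96, from the empty face and the constant in the weight bound.
theorem1p2 = 1626 , bound
  where
  bound : ∀ (n : ℕ) → 5 ≤ n → ∀ (H : SimplicialComplex n) → ¬ ContainsCopy BEdge H → 16 * numEdges H ≤ 18 * (n C 2) + 21 * n + 16 * 1626
  bound n 5≤n H free with maximum (≤-trans (s≤s z≤n) 5≤n) (Links.W (linkSystem H free))
  ... | v , maximal = subst (λ k → 16 * k ≤ 18 * (n C 2) + 21 * n + 16 * 1626)
    (sym (subsetSum-levels 5 (edgeInd H) (large-not-edge H free)))
    (final-count {n} {levelSum 0 (edgeInd H)} {levelSum 1 (edgeInd H)} {levelSum 2 (edgeInd H)} {levelSum 3 (edgeInd H)} {levelSum 4 (edgeInd H)}
      {M = sum₂ (λ x y → ⟦ Links.miss? (linkSystem H free) x y ⟧)} {w = sum (Links.W (linkSystem H free))} {B = n C 2}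
      (≤-trans (≤-reflexive (levelSum-∅ (edgeInd H))) (ι≤1 (edge H ∅)))
      (count₁ H) (count₂ H) (count₃ H) (count₄ H)
      (Links.charging (linkSystem H free)) (total-weight-≤ (linkSystem H free) v maximal)
      (pair-count (linkSystem H free)) (2*nC2+n≡n² n))
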